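{- Let $P=\{y_1,\dots,y_p\}$ be a finite poset in which $y_1$ is the unique maximal element and $y_2$ is covered by $y_1$, and let $m,k\ge1$ be integers. Let $D_{m,k}(P)$ be the poset obtained from $P$ by adding a disjoint chain $z_m>\dots>z_1>z_0>z_{ -1}>\dots>z_{ -k}$ and a new element $y_0$, with the additional covering relations $z_1>y_0$, $z_0>y_1$, $z_{ -1}>y_2$ and $y_0>y_1$ (the order being the transitive closure), and let $D_k(P)$ be obtained from $D_{m,k}(P)$ by removing $z_m,\dots,z_1$ and $y_0$. Let $P^+$ be $P$ with a new element added above all elements of $P$. Then \[ \mathrm{GF}(D_{m,k}(P))=\frac{1}{(q^{p+k+1};q)_{m+2}}\left(\frac{q^{p+1}}{(q;q)_{k-1}}\mathrm{GF}(P^+)+(1-q^{2p+2k+2})\,\mathrm{GF}(D_k(P))\right). \]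
   Context: For a finite poset $Q$, a $Q$-partition is a map $\sigma:Q\to\mathbb{N}=\{0,1,\dots\}$ with $x\le_Q y\Rightarrow\sigma(x)\ge\sigma(y)$; $|\sigma|=\sum_x\sigma(x)$ and $\mathrm{GF}(Q)=\sum_\sigma q^{|\sigma|}$ over all $Q$-partitions. Notation: $(a;q)_n=(1-a)(1-aq)\cdots(1-aq^{n-1})$, $(a;q)_0=1$. -}

module Defs where

open import Level using (Level; 0ℓ)
open import Data.Nat using (ℕ; zero; suc; _+_; _*_; _∸_; _≤_; _≤ᵇ_)
open import Data.Integer as ℤ using (ℤ; +_)
open import Data.Fin using (Fin; zero; suc; toℕ; splitAt; _↑ˡ_)
open import Data.Sum using (_⊎_; inj₁; inj₂)
open import Data.Product using (Σ; _×_; ∃)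
open import Data.Vec using (Vec; lookup; sum)
open import Data.List using (List; length)
open import Data.List.Relation.Unary.Unique.Propositional using (Unique)
open import Data.List.Membership.Propositional using (_∈_)
open import Data.Bool using (if_then_else_)
open import Function.Bundles using (_⇔_)
open import Relation.Binary using (Rel)
open import Relation.Binary.PropositionalEquality using (_≡_; _≢_)
open import Relation.Binary.Construct.Closure.ReflexiveTransitive using (Star)
open import Relation.Nullary using (¬_)

_<[_]_ : ∀ {n} → Fin n → Rel (Fin n) 0ℓ → Fin n → Set
x <[ R ] y = R x y × x ≢ y

Maximal : ∀ {n} → Rel (Fin n) 0ℓ → Fin n → Set
Maximal R x = ∀ w → R x w → w ≡ x

UniqueMaximal : ∀ {n} → Rel (Fin n) 0ℓ → Fin n → Set
UniqueMaximal R x = Maximal R x × (∀ w → Maximal R w → w ≡ x)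

CoveredBy : ∀ {n} → Rel (Fin n) 0ℓ → Fin n → Fin n → Set
CoveredBy R y x = (y <[ R ] x) × ¬ (∃ λ w → (y <[ R ] w) × (w <[ R ] x))

-- Q-partitions and generating-function coefficients.
-- A poset Q is a carrier Fin n with order R (R i j means i ≤_Q j).
-- A Q-partition is σ : Vec ℕ n with i ≤_Q j ⇒ σ(i) ≥ σ(j).

IsPartition : ∀ {n} → Rel (Fin n) 0ℓ → Vec ℕ n → Set
IsPartition R σ = ∀ i j → R i j → lookup σ j ≤ lookup σ i

IsGF : ∀ {n} → Rel (Fin n) 0ℓ → (ℕ → ℕ) → Set
IsGF {n} R f = ∀ N → Σ (List (Vec ℕ n)) λ L →
  Unique L × (∀ σ → (σ ∈ L) ⇔ (IsPartition R σ × sum σ ≡ N)) × length L ≡ f N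

-- Elements of D_{m,k}(P): y a (a ∈ P), y0, and z t for t : Fin (suc k + m),
-- where z t stands for z_i with t = k + i  (i = -k, …, m).
data DElem (p c : ℕ) : Set where
  y  : Fin p → DElem p c
  y0 : DElem p c
  z  : Fin c → DElem p c

module _ {p : ℕ} (_≤P_ : Rel (Fin p) 0ℓ) (y1 y2 : Fin p) (m k : ℕ) where

  data Gen : DElem p (suc k + m) → DElem p (suc k + m) → Set where
    inP   : ∀ {a b} → a ≤P b → Gen (y a) (y b)
    chain : ∀ {s t} → toℕ s ≤ toℕ t → Gen (z s) (z t)
    y0z1  : ∀ {t} → toℕ t ≡ k + 1 → Gen y0 (z t)
    y1z0  : ∀ {t} → toℕ t ≡ k → Gen (y y1) (z t)
    y2zm1 : ∀ {t} → toℕ t + 1 ≡ k → Gen (y y2) (z t)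
    y1y0  : Gen (y y1) y0

  _≤D_ : Rel (DElem p (suc k + m)) 0ℓ
  _≤D_ = Star Gen

  decodeD : Fin (p + suc (suc k + m)) → DElem p (suc k + m)
  decodeD i with splitAt p i
  ... | inj₁ a = y a
  ... | inj₂ zero = y0
  ... | inj₂ (suc t) = z t

  DOrder : Rel (Fin (p + suc (suc k + m))) 0ℓ
  DOrder i j = decodeD i ≤D decodeD j

  -- D_k(P): the induced subposet of D_{m,k}(P) on P ∪ {z_0,…,z_{-k}},
  -- on Fin (p + suc k): first P, then z t (t = k + i, i = -k,…,0)
  decodeDk : Fin (p + suc k) → DElem p (suc k + m)
  decodeDk i with splitAt p i
  ... | inj₁ a = y a
  ... | inj₂ t = z (t ↑ˡ m)

  DkOrder : Rel (Fin (p + suc k)) 0ℓ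
  DkOrder i j = decodeDk i ≤D decodeDk j

data PlusElem (p : ℕ) : Set where
  old : Fin p → PlusElem p
  top : PlusElem p

decodePlus : ∀ {p} → Fin (p + 1) → PlusElem p
decodePlus {p} i with splitAt p i
... | inj₁ a = old a
... | inj₂ _ = top

data PlusLe {p : ℕ} (_≤P_ : Rel (Fin p) 0ℓ) : PlusElem p → PlusElem p → Set where
  old≤old : ∀ {a b} → a ≤P b → PlusLe _≤P_ (old a) (old b)
  ≤top    : ∀ {x} → PlusLe _≤P_ x top

PlusOrder : ∀ {p} → Rel (Fin p) 0ℓ → Rel (Fin (p + 1)) 0ℓ
PlusOrder R i j = PlusLe R (decodePlus i) (decodePlus j)

PS : Set
PS = ℕ → ℤ

_⊕_ : PS → PS → PS
(f ⊕ g) n = f n ℤ.+ g n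

_⊖_ : PS → PS → PS
(f ⊖ g) n = f n ℤ.- g n

qPow* : ℕ → PS → PS
qPow* a f n = if a ≤ᵇ n then f (n ∸ a) else + 0

oneMinusQPow* : ℕ → PS → PS
oneMinusQPow* a f = f ⊖ qPow* a f

sumTo : ℕ → (ℕ → ℤ) → ℤ
sumTo zero    g = g 0
sumTo (suc J) g = sumTo J g ℤ.+ g (suc J)

-- division by (1 - q^a) for a ≥ 1, i.e. multiplication by Σ_j q^{j a}:
-- coefficient n is Σ_{j ≥ 0, j a ≤ n} f(n - j a)  (j ≤ n suffices as a ≥ 1)
divOneMinusQPow : ℕ → PS → PS
divOneMinusQPow a f n = sumTo n (λ j → if (j * a) ≤ᵇ n then f (n ∸ j * a) else + 0)

-- division by (q^a; q)_r = (1-q^a)(1-q^{a+1})⋯(1-q^{a+r-1}), for a ≥ 1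
divPoch : ℕ → ℕ → PS → PS
divPoch a zero    f = f
divPoch a (suc r) f = divPoch (suc a) r (divOneMinusQPow a f)

toPS : (ℕ → ℕ) → PS
toPS f n = + (f n)

module Submission where

-- Power series are
-- coefficient sequences over ℤ; the one analytic fact needed is that
-- F = g + q^a F with a ≥ 1 forces F = g / (1 - q^a), which gives the
-- Pochhammer quotients and an elimination of four recurrences (Series).
--
-- The basic recurrence peels a minimal entry: either it is 0 and can be
-- deleted, or all entries are positive and drop by 1, so that
-- GF(Q) = GF(Q without its top) + q^|Q| GF(Q) (Recurrences).  Applied to the
-- auxiliary posets R = P ∪ {z₋₁ > ⋯ > z₋ₖ}, D_k, S = R ∪ {y0}, E = D_{0,k},
-- X m = D_{m,k} and W j = P⁺ ⊔ (j-chain) (Models), with a = p + k + 1 it gives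
--   X m = E / (q^(a+2); q)_m,     E = (U + (1 - q^(2a)) D_k) / ((1 - q^a)(1 - q^(a+1))),
--   U = q^(p+1) W (k-1),          W (k-1) = P⁺ / (q; q)_(k-1).
-- The frozen posets D_{m,k}(P), D_k(P) and P⁺ are matched with X m, D_k and
-- W 0 by rearranging their vectors and reversing their chains (Vectors, Encoding).
-- Finally the order of P need not be decidable: the claim is an equation in ℤ,
-- hence stable under double negation, and finitely many instances of excluded
-- middle hold up to double negation (Assembly).

open import Defs using (UniqueMaximal; CoveredBy; IsGF; DOrder; DkOrder; PlusOrder; toPS; divPoch; qPow*; oneMinusQPow*; _⊕_)
open import Level using (0ℓ)
open import Data.Nat using (ℕ; suc; _+_; _*_; _∸_; _≤_)
open import Data.Fin using (Fin)
import Data.Integer as ℤ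
open import Relation.Binary using (Rel; IsPartialOrder)
open import Relation.Nullary using (Dec)
open import Relation.Nullary.Decidable using (decidable-stable)
open import Relation.Nullary.Negation using (¬¬-map)
open import Relation.Binary.PropositionalEquality using (_≡_)

module Counting where
  open import Data.Nat using (ℕ; zero; suc; _+_)
  import Data.Nat.Properties as ℕP
  open import Data.List as List using (List; []; _∷_; length; filter)
  open import Data.List.Properties using (length-map; map-∘; map-id-local)
  open import Data.List.Relation.Unary.Unique.Propositional using (Unique; []; _∷_)
  open import Data.List.Relation.Binary.Disjoint.Propositional using (Disjoint)
  import Data.List.Relation.Unary.All as ListAll
  import Data.List.Relation.Unary.Unique.Propositional.Properties as Unique
  open import Data.List.Relation.Unary.Any using (here; there)
  open import Data.List.Membership.Propositional using (_∈_)
  open import Data.List.Membership.Propositional.Properties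
    using (∈-filter⁺; ∈-filter⁻; ∈-map⁺; ∈-map⁻; ∈-++⁺ˡ; ∈-++⁺ʳ; ∈-++⁻)
  open import Data.List.Membership.Propositional.Properties.WithK using (unique∧set⇒bag)
  open import Data.List.Relation.Binary.BagAndSetEquality using (∼bag⇒↭)
  open import Data.List.Relation.Binary.Permutation.Propositional.Properties using (↭-length)
  open import Data.Vec using (Vec; []; _∷_; sum)
  open import Data.Vec.Properties using (∷-injective; ∷-injectiveʳ)
  open import Data.Product using (_×_; _,_; proj₂)
  open import Data.Sum using (inj₁; inj₂)
  open import Data.Empty using (⊥-elim)
  open import Function.Bundles using (_⇔_; mk⇔; Equivalence)
  open import Relation.Nullary using (¬_; yes; no)
  open import Relation.Unary using (Pred; Decidable)
  open import Relation.Unary.Properties using (_∩?_; ∁?)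
  open import Relation.Binary.PropositionalEquality

  raiseHead : ∀ {n} → Vec ℕ (suc n) → Vec ℕ (suc n)
  raiseHead (a ∷ τ) = suc a ∷ τ

  compositions : (n N : ℕ) → List (Vec ℕ n)
  compositions zero    zero    = [] ∷ []
  compositions zero    (suc N) = []
  compositions (suc n) zero    = List.map (0 ∷_) (compositions n zero)
  compositions (suc n) (suc N) =
    List.map (0 ∷_) (compositions n (suc N)) List.++ List.map raiseHead (compositions (suc n) N)

  compositions-sound : ∀ n N {σ} → σ ∈ compositions n N → sum σ ≡ N
  compositions-sound zero    zero    (here refl) = refl
  compositions-sound (suc n) zero    σ∈ with ∈-map⁻ (0 ∷_) σ∈
  ... | τ , τ∈ , refl = compositions-sound n zero τ∈
  compositions-sound (suc n) (suc N) σ∈ with ∈-++⁻ (List.map (0 ∷_) (compositions n (suc N))) σ∈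
  ... | inj₁ σ∈₁ with ∈-map⁻ (0 ∷_) σ∈₁
  ...   | τ , τ∈ , refl = compositions-sound n (suc N) τ∈
  compositions-sound (suc n) (suc N) σ∈ | inj₂ σ∈₂ with ∈-map⁻ raiseHead σ∈₂
  ...   | (a ∷ τ) , τ∈ , refl = cong suc (compositions-sound (suc n) N τ∈)

  compositions-complete : ∀ n {N} (σ : Vec ℕ n) → sum σ ≡ N → σ ∈ compositions n N
  compositions-complete zero    {zero}  []          _  = here refl
  compositions-complete (suc n) {zero}  (zero ∷ τ)  eq = ∈-map⁺ (0 ∷_) (compositions-complete n τ eq)
  compositions-complete (suc n) {suc N} (zero ∷ τ)  eq = ∈-++⁺ˡ (∈-map⁺ (0 ∷_) (compositions-complete n τ eq))
  compositions-complete (suc n) {suc N} (suc a ∷ τ) eq =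
    ∈-++⁺ʳ _ (∈-map⁺ raiseHead (compositions-complete (suc n) (a ∷ τ) (ℕP.suc-injective eq)))

  compositions-unique : ∀ n N → Unique (compositions n N)
  compositions-unique zero    zero    = ListAll.[] ∷ []
  compositions-unique zero    (suc N) = []
  compositions-unique (suc n) zero    = Unique.map⁺ ∷-injectiveʳ (compositions-unique n zero)
  compositions-unique (suc n) (suc N) =
    Unique.++⁺ (Unique.map⁺ ∷-injectiveʳ (compositions-unique n (suc N)))
               (Unique.map⁺ raiseHead-injective (compositions-unique (suc n) N))
               headsDiffer
    where
    raiseHead-injective : ∀ {x y : Vec ℕ (suc n)} → raiseHead x ≡ raiseHead y → x ≡ y
    raiseHead-injective {a ∷ τ} {b ∷ τ′} eq with ∷-injective eq
    ... | refl , refl = refl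
    headsDiffer : Disjoint (List.map (0 ∷_) (compositions n (suc N))) (List.map raiseHead (compositions (suc n) N))
    headsDiffer (σ∈₁ , σ∈₂) with ∈-map⁻ (0 ∷_) σ∈₁ | ∈-map⁻ raiseHead σ∈₂
    ... | τ , _ , refl | (a ∷ τ′) , _ , ()

  Enumerates : ∀ {n} → Pred (Vec ℕ n) 0ℓ → ℕ → List (Vec ℕ n) → Set
  Enumerates P N L = Unique L × (∀ σ → σ ∈ L ⇔ (P σ × sum σ ≡ N))

  Transfers : ∀ {n n′} → Pred (Vec ℕ n) 0ℓ → ℕ → Pred (Vec ℕ n′) 0ℓ → ℕ →
              (Vec ℕ n → Vec ℕ n′) → (Vec ℕ n′ → Vec ℕ n) → Set
  Transfers P N Q N′ g h = ∀ σ → P σ → sum σ ≡ N → Q (g σ) × sum (g σ) ≡ N′ × h (g σ) ≡ σ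

  sameMembers-length : ∀ {A : Set} {xs ys : List A} → Unique xs → Unique ys →
                       (∀ z → z ∈ xs ⇔ z ∈ ys) → length xs ≡ length ys
  sameMembers-length u v same = ↭-length (∼bag⇒↭ (unique∧set⇒bag u v (λ {z} → same z)))

  enumeration-bijection : ∀ {n n′} {P : Pred (Vec ℕ n) 0ℓ} {Q : Pred (Vec ℕ n′) 0ℓ} {N N′ L L′}
    {g : Vec ℕ n → Vec ℕ n′} {h : Vec ℕ n′ → Vec ℕ n} →
    Enumerates P N L → Enumerates Q N′ L′ → Transfers P N Q N′ g h → Transfers Q N′ P N h g →
    length L ≡ length L′
  enumeration-bijection {L = L} {L′} {g} {h} (uL , memL) (uL′ , memL′) gh hg = begin
    length L              ≡⟨ sym (length-map g L) ⟩
    length (List.map g L) ≡⟨ sameMembers-length unique-gL uL′ sameMembers ⟩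
    length L′             ∎
    where
    open ≡-Reasoning
    forth : ∀ {σ} → σ ∈ L → _
    forth {σ} σ∈ = let (pσ , sσ) = Equivalence.to (memL σ) σ∈ in gh σ pσ sσ
    hgL : List.map h (List.map g L) ≡ L
    hgL = trans (sym (map-∘ L)) (map-id-local (ListAll.tabulate (λ σ∈ → proj₂ (proj₂ (forth σ∈)))))
    unique-gL : Unique (List.map g L)
    unique-gL = Unique.map⁻ (subst Unique (sym hgL) uL)
    sameMembers : ∀ τ → τ ∈ List.map g L ⇔ τ ∈ L′
    sameMembers τ = mk⇔ to from
      where
      to : τ ∈ List.map g L → τ ∈ L′
      to τ∈ with ∈-map⁻ g τ∈
      ... | σ , σ∈ , refl = let (qτ , sτ , _) = forth σ∈ in Equivalence.from (memL′ _) (qτ , sτ)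
      from : τ ∈ L′ → τ ∈ List.map g L
      from τ∈ with Equivalence.to (memL′ τ) τ∈
      ... | qτ , sτ with hg τ qτ sτ
      ...   | pσ , sσ , ghτ = subst (_∈ List.map g L) ghτ (∈-map⁺ g (Equivalence.from (memL _) (pσ , sσ)))

  count : ∀ {n} {P : Pred (Vec ℕ n) 0ℓ} → Decidable P → ℕ → ℕ
  count {n} P? N = length (filter P? (compositions n N))

  count-enumerates : ∀ {n} {P : Pred (Vec ℕ n) 0ℓ} (P? : Decidable P) N →
                     Enumerates P N (filter P? (compositions n N))
  count-enumerates {n} P? N = Unique.filter⁺ P? (compositions-unique n N) , λ σ → mk⇔
    (λ σ∈ → let (σ∈′ , pσ) = ∈-filter⁻ P? σ∈ in pσ , compositions-sound n N σ∈′)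
    (λ (pσ , sσ) → ∈-filter⁺ P? (compositions-complete n σ sσ) pσ)

  count-bijection : ∀ {n n′} {P : Pred (Vec ℕ n) 0ℓ} {Q : Pred (Vec ℕ n′) 0ℓ}
    (P? : Decidable P) (Q? : Decidable Q) {N N′} {g : Vec ℕ n → Vec ℕ n′} {h : Vec ℕ n′ → Vec ℕ n} →
    Transfers P N Q N′ g h → Transfers Q N′ P N h g → count P? N ≡ count Q? N′
  count-bijection P? Q? {N} {N′} =
    enumeration-bijection (count-enumerates P? N) (count-enumerates Q? N′)

  count-cong : ∀ {n} {P Q : Pred (Vec ℕ n) 0ℓ} (P? : Decidable P) (Q? : Decidable Q) N →
    (∀ σ → P σ → Q σ) → (∀ σ → Q σ → P σ) → count P? N ≡ count Q? N
  count-cong P? Q? N P⇒Q Q⇒P =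
    count-bijection P? Q? (λ σ pσ sσ → P⇒Q σ pσ , sσ , refl) (λ σ qσ sσ → Q⇒P σ qσ , sσ , refl)

  count-split : ∀ {n} {P R : Pred (Vec ℕ n) 0ℓ} (P? : Decidable P) (R? : Decidable R) N →
    count P? N ≡ count (P? ∩? R?) N + count (P? ∩? ∁? R?) N
  count-split {n} P? R? N = filter-split (compositions n N)
    where
    filter-split : ∀ L → length (filter P? L) ≡ length (filter (P? ∩? R?) L) + length (filter (P? ∩? ∁? R?) L)
    filter-split [] = refl
    filter-split (σ ∷ L) with P? σ | R? σ
    ... | yes _ | yes _ = cong suc (filter-split L)
    ... | yes _ | no _  = trans (cong suc (filter-split L)) (sym (ℕP.+-suc _ _))
    ... | no _  | yes _ = filter-split L
    ... | no _  | no _  = filter-split L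

  count-none : ∀ {n} {P : Pred (Vec ℕ n) 0ℓ} (P? : Decidable P) N →
    (∀ σ → P σ → sum σ ≢ N) → count P? N ≡ 0
  count-none {n} {P} P? N none = filter-none (compositions n N) (λ {σ} σ∈ pσ → none σ pσ (compositions-sound n N σ∈))
    where
    filter-none : ∀ L → (∀ {σ} → σ ∈ L → ¬ P σ) → length (filter P? L) ≡ 0
    filter-none [] _ = refl
    filter-none (σ ∷ L) f with P? σ
    ... | yes pσ = ⊥-elim (f (here refl) pσ)
    ... | no _   = filter-none L (λ σ∈ → f (there σ∈))

module Series where
  open import Defs using (PS; _⊕_; _⊖_; qPow*; oneMinusQPow*; sumTo; divOneMinusQPow; divPoch)
  open import Data.Nat using (ℕ; zero; suc; _+_; _*_; _∸_; _≤_; _<_; _≤ᵇ_; _≤?_; z≤n; s≤s)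
  import Data.Nat.Properties as ℕP
  open import Data.Nat.Induction using (<-rec)
  open import Data.Integer as ℤ using (ℤ; +_)
  import Data.Integer.Properties as ℤP
  open import Data.Integer.Tactic.RingSolver using (solve-∀)
  open import Data.Bool using (true; false)
  open import Data.Empty using (⊥-elim)
  open import Relation.Nullary using (¬_; yes; no)
  open import Relation.Nullary.Reflects using (ofʸ; ofⁿ)
  open import Relation.Binary using (Setoid)
  import Relation.Binary.Reasoning.Setoid as SetoidReasoning
  open import Relation.Binary.PropositionalEquality

  infix 4 _≈_
  _≈_ : PS → PS → Set
  f ≈ g = ∀ N → f N ≡ g N

  PS-setoid : Setoid _ _
  PS-setoid = record
    { Carrier = PS ; _≈_ = _≈_
    ; isEquivalence = record
      { refl = λ N → refl ; sym = λ e N → sym (e N) ; trans = λ e e′ N → trans (e N) (e′ N) } }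

  ≈-sym : ∀ {f g} → f ≈ g → g ≈ f
  ≈-sym f≈g N = sym (f≈g N)

  ⊕-congˡ : ∀ {f f′} h → f ≈ f′ → f ⊕ h ≈ f′ ⊕ h
  ⊕-congˡ h f≈f′ N = cong (ℤ._+ h N) (f≈f′ N)

  ⊕-congʳ : ∀ h {f f′} → f ≈ f′ → h ⊕ f ≈ h ⊕ f′
  ⊕-congʳ h f≈f′ N = cong (λ x → h N ℤ.+ x) (f≈f′ N)

  ⊕-assoc : ∀ f g h → (f ⊕ g) ⊕ h ≈ f ⊕ (g ⊕ h)
  ⊕-assoc f g h N = ℤP.+-assoc (f N) (g N) (h N)

  module ≈-Reasoning = SetoidReasoning PS-setoid

  qPow*-≤ : ∀ {w N} (f : PS) → w ≤ N → qPow* w f N ≡ f (N ∸ w)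
  qPow*-≤ {w} {N} f w≤N with w ≤ᵇ N | ℕP.≤ᵇ-reflects-≤ w N
  ... | true  | _        = refl
  ... | false | ofⁿ w≰N = ⊥-elim (w≰N w≤N)

  qPow*-≰ : ∀ {w N} (f : PS) → ¬ w ≤ N → qPow* w f N ≡ + 0
  qPow*-≰ {w} {N} f w≰N with w ≤ᵇ N | ℕP.≤ᵇ-reflects-≤ w N
  ... | true  | ofʸ w≤N = ⊥-elim (w≰N w≤N)
  ... | false | _       = refl

  qPow*-cong : ∀ w {f g} → f ≈ g → qPow* w f ≈ qPow* w g
  qPow*-cong w {f} {g} f≈g N with w ≤? N
  ... | yes w≤N = trans (qPow*-≤ f w≤N) (trans (f≈g (N ∸ w)) (sym (qPow*-≤ g w≤N)))
  ... | no  w≰N = trans (qPow*-≰ f w≰N) (sym (qPow*-≰ g w≰N))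

  oneMinusQPow*-cong : ∀ a {f g} → f ≈ g → oneMinusQPow* a f ≈ oneMinusQPow* a g
  oneMinusQPow*-cong a f≈g N = cong₂ ℤ._-_ (f≈g N) (qPow*-cong a f≈g N)

  qPow*-pointwise : ∀ w (op : ℤ → ℤ → ℤ) → op (+ 0) (+ 0) ≡ + 0 → ∀ f g →
    qPow* w (λ n → op (f n) (g n)) ≈ λ n → op (qPow* w f n) (qPow* w g n)
  qPow*-pointwise w op op00 f g N with w ≤? N
  ... | yes w≤N = trans (qPow*-≤ (λ n → op (f n) (g n)) w≤N) (sym (cong₂ op (qPow*-≤ f w≤N) (qPow*-≤ g w≤N)))
  ... | no  w≰N = trans (qPow*-≰ (λ n → op (f n) (g n)) w≰N) (sym (trans (cong₂ op (qPow*-≰ f w≰N) (qPow*-≰ g w≰N)) op00))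

  qPow*-⊕ : ∀ w f g → qPow* w (f ⊕ g) ≈ qPow* w f ⊕ qPow* w g
  qPow*-⊕ w = qPow*-pointwise w ℤ._+_ refl

  qPow*-⊖ : ∀ w f g → qPow* w (f ⊖ g) ≈ qPow* w f ⊖ qPow* w g
  qPow*-⊖ w = qPow*-pointwise w ℤ._-_ refl

  qPow*-qPow* : ∀ v w f → qPow* v (qPow* w f) ≈ qPow* (v + w) f
  qPow*-qPow* v w f N with v ≤? N
  ... | no v≰N = trans (qPow*-≰ (qPow* w f) v≰N) (sym (qPow*-≰ f (λ le → v≰N (ℕP.≤-trans (ℕP.m≤m+n v w) le))))
  ... | yes v≤N with w ≤? N ∸ v
  ...   | yes w≤N∸v = begin
    qPow* v (qPow* w f) N ≡⟨ qPow*-≤ (qPow* w f) v≤N ⟩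
    qPow* w f (N ∸ v)     ≡⟨ qPow*-≤ f w≤N∸v ⟩
    f (N ∸ v ∸ w)         ≡⟨ cong f (ℕP.∸-+-assoc N v w) ⟩
    f (N ∸ (v + w))       ≡⟨ qPow*-≤ f v+w≤N ⟨
    qPow* (v + w) f N     ∎
    where
    open ≡-Reasoning
    v+w≤N : v + w ≤ N
    v+w≤N = subst (v + w ≤_) (ℕP.m+[n∸m]≡n v≤N) (ℕP.+-monoʳ-≤ v w≤N∸v)
  ...   | no w≰N∸v = trans (qPow*-≤ (qPow* w f) v≤N) (trans (qPow*-≰ f w≰N∸v) (sym (qPow*-≰ f v+w≰N)))
    where
    v+w≰N : ¬ v + w ≤ N
    v+w≰N le = w≰N∸v (ℕP.m+n≤o⇒m≤o∸n w (subst (_≤ N) (ℕP.+-comm v w) le))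

  sumTo-cong : ∀ J {h h′ : ℕ → ℤ} → (∀ j → j ≤ J → h j ≡ h′ j) → sumTo J h ≡ sumTo J h′
  sumTo-cong zero    h≡h′ = h≡h′ 0 z≤n
  sumTo-cong (suc J) h≡h′ = cong₂ ℤ._+_ (sumTo-cong J (λ j j≤J → h≡h′ j (ℕP.m≤n⇒m≤1+n j≤J))) (h≡h′ (suc J) ℕP.≤-refl)

  sumTo-suc : ∀ J h → sumTo (suc J) h ≡ h 0 ℤ.+ sumTo J (λ j → h (suc j))
  sumTo-suc zero    h = refl
  sumTo-suc (suc J) h = trans (cong (ℤ._+ h (suc (suc J))) (sumTo-suc J h))
                              (ℤP.+-assoc (h 0) (sumTo J (λ j → h (suc j))) (h (suc (suc J))))

  sumTo-zero : ∀ J h → (∀ j → h j ≡ + 0) → sumTo J h ≡ + 0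
  sumTo-zero zero    h h≡0 = h≡0 0
  sumTo-zero (suc J) h h≡0 = cong₂ ℤ._+_ (sumTo-zero J h h≡0) (h≡0 (suc J))

  sumTo-extend : ∀ J d h → (∀ j → J < j → h j ≡ + 0) → sumTo (J + d) h ≡ sumTo J h
  sumTo-extend J zero    h tail≡0 = cong (λ J′ → sumTo J′ h) (ℕP.+-identityʳ J)
  sumTo-extend J (suc d) h tail≡0 = begin
    sumTo (J + suc d) h                    ≡⟨ cong (λ J′ → sumTo J′ h) (ℕP.+-suc J d) ⟩
    sumTo (J + d) h ℤ.+ h (suc (J + d))    ≡⟨ cong₂ ℤ._+_ (sumTo-extend J d h tail≡0) (tail≡0 _ (s≤s (ℕP.m≤m+n J d))) ⟩
    sumTo J h ℤ.+ + 0                      ≡⟨ ℤP.+-identityʳ _ ⟩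
    sumTo J h                              ∎
    where open ≡-Reasoning

  divOneMinusQPow-terms : ∀ a g N → divOneMinusQPow a g N ≡ sumTo N (λ j → qPow* (j * a) g N)
  divOneMinusQPow-terms a g N = refl

  divOneMinusQPow-rec : ∀ a → 1 ≤ a → ∀ g → divOneMinusQPow a g ≈ g ⊕ qPow* a (divOneMinusQPow a g)
  divOneMinusQPow-rec a 1≤a g zero =
    sym (trans (cong (λ x → g 0 ℤ.+ x) (qPow*-≰ (divOneMinusQPow a g) (ℕP.<⇒≱ 1≤a))) (ℤP.+-identityʳ (g 0)))
  divOneMinusQPow-rec a@(suc a′) _ g N@(suc N′) =
    trans (divOneMinusQPow-terms a g N) (trans (sumTo-suc N′ (λ j → qPow* (j * a) g N)) (cong (λ x → g N ℤ.+ x) later-terms))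
    where
    later-terms : sumTo N′ (λ j → qPow* (suc j * a) g N) ≡ qPow* a (divOneMinusQPow a g) N
    later-terms with a ≤? N
    ... | no a≰N = trans (sumTo-zero N′ _ (λ j → qPow*-≰ g (λ le → a≰N (ℕP.≤-trans (ℕP.m≤m+n a (j * a)) le))))
                         (sym (qPow*-≰ (divOneMinusQPow a g) a≰N))
    ... | yes a≤N = begin
      sumTo N′ (λ j → qPow* (suc j * a) g N)
        ≡⟨ cong (λ J → sumTo J (λ j → qPow* (suc j * a) g N)) (ℕP.m+[n∸m]≡n M≤N′) ⟨
      sumTo (M + (N′ ∸ M)) (λ j → qPow* (suc j * a) g N)
        ≡⟨ sumTo-extend M (N′ ∸ M) _ (λ j M<j → qPow*-≰ g (λ le → ℕP.<⇒≱ (beyond j M<j) le)) ⟩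
      sumTo M (λ j → qPow* (suc j * a) g N)
        ≡⟨ sumTo-cong M (λ j _ → trans (sym (qPow*-qPow* a (j * a) g N)) (qPow*-≤ (qPow* (j * a) g) a≤N)) ⟩
      sumTo M (λ j → qPow* (j * a) g M)
        ≡⟨ divOneMinusQPow-terms a g M ⟨
      divOneMinusQPow a g M
        ≡⟨ qPow*-≤ (divOneMinusQPow a g) a≤N ⟨
      qPow* a (divOneMinusQPow a g) N ∎
      where
      open ≡-Reasoning
      M = N ∸ a
      M≤N′ : M ≤ N′
      M≤N′ = ℕP.∸-monoʳ-≤ {1} {a} N (s≤s z≤n)
      beyond : ∀ j → M < j → N < suc j * a
      beyond j M<j = ℕP.<-≤-trans (subst (_< a + j) (ℕP.m+[n∸m]≡n a≤N) (ℕP.+-monoʳ-< a M<j))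
                                   (ℕP.+-monoʳ-≤ a (ℕP.m≤m*n j a))

  solve-recurrence : ∀ a → 1 ≤ a → ∀ {f g} → f ≈ g ⊕ qPow* a f → f ≈ divOneMinusQPow a g
  solve-recurrence a 1≤a {f} {g} rec = <-rec (λ N → f N ≡ F N) step
    where
    F = divOneMinusQPow a g
    step : ∀ N → (∀ {M} → M < N → f M ≡ F M) → f N ≡ F N
    step N ih = begin
      f N                       ≡⟨ rec N ⟩
      g N ℤ.+ qPow* a f N       ≡⟨ cong (λ x → g N ℤ.+ x) shifted ⟩
      g N ℤ.+ qPow* a F N       ≡⟨ divOneMinusQPow-rec a 1≤a g N ⟨
      F N                       ∎
      where
      open ≡-Reasoning
      shifted : qPow* a f N ≡ qPow* a F N
      shifted with a ≤? N
      ... | yes a≤N = trans (qPow*-≤ f a≤N) (trans (ih (ℕP.∸-monoʳ-< 1≤a a≤N)) (sym (qPow*-≤ F a≤N)))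
      ... | no  a≰N = trans (qPow*-≰ f a≰N) (sym (qPow*-≰ F a≰N))

  divOneMinusQPow-cong : ∀ a {f g} → f ≈ g → divOneMinusQPow a f ≈ divOneMinusQPow a g
  divOneMinusQPow-cong a f≈g N = sumTo-cong N (λ j _ → qPow*-cong (j * a) f≈g N)

  divPoch-cong : ∀ a r {f g} → f ≈ g → divPoch a r f ≈ divPoch a r g
  divPoch-cong a zero    f≈g = f≈g
  divPoch-cong a (suc r) f≈g = divPoch-cong (suc a) r (divOneMinusQPow-cong a f≈g)

  divPoch-snoc : ∀ a r f → divPoch a (suc r) f ≈ divOneMinusQPow (a + r) (divPoch a r f)
  divPoch-snoc a zero    f N = cong (λ b → divOneMinusQPow b f N) (sym (ℕP.+-identityʳ a))
  divPoch-snoc a (suc r) f N = trans (divPoch-snoc (suc a) r (divOneMinusQPow a f) N)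
    (cong (λ b → divOneMinusQPow b (divPoch a (suc r) f) N) (sym (ℕP.+-suc a r)))

  pochhammer-chain : ∀ c → 1 ≤ c → (Y : ℕ → PS) →
    (∀ j → Y (suc j) ≈ Y j ⊕ qPow* (c + j) (Y (suc j))) → ∀ j → Y j ≈ divPoch c j (Y 0)
  pochhammer-chain c 1≤c Y rec zero    N = refl
  pochhammer-chain c 1≤c Y rec (suc j) N = begin
    Y (suc j) N                                         ≡⟨ solve-recurrence (c + j) (ℕP.≤-trans 1≤c (ℕP.m≤m+n c j)) {g = Y j} (rec j) N ⟩
    divOneMinusQPow (c + j) (Y j) N                     ≡⟨ divOneMinusQPow-cong (c + j) (pochhammer-chain c 1≤c Y rec j) N ⟩
    divOneMinusQPow (c + j) (divPoch c j (Y 0)) N       ≡⟨ divPoch-snoc c j (Y 0) N ⟨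
    divPoch c (suc j) (Y 0) N                           ∎
    where open ≡-Reasoning

  difference : ∀ {f g h} → f ≈ g ⊕ h → h ≈ f ⊖ g
  difference {f} {g} {h} f≈g+h N = sym (trans (cong (ℤ._- g N) (f≈g+h N)) (cancel (g N) (h N)))
    where
    cancel : ∀ x y → (x ℤ.+ y) ℤ.- x ≡ y
    cancel = solve-∀

  -- Elimination of the four recurrences that govern D_{0,k} (proof of Lemma 3.4 with m = 0):
  --   Dk = R + q^a Dk,   S = R + S₁,   S = R + U + q^a S,   E = Dk + S₁ + q^(a+1) E
  -- force E = (U + (1 - q^(2a)) Dk) / ((1 - q^a) (1 - q^(a+1))).
  four-recurrences : ∀ a → 1 ≤ a → ∀ {Dk R S S₁ U E : PS} →
    Dk ≈ R ⊕ qPow* a Dk → S ≈ R ⊕ S₁ → S ≈ (R ⊕ U) ⊕ qPow* a S →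
    E ≈ (Dk ⊕ S₁) ⊕ qPow* (suc a) E →
    E ≈ divOneMinusQPow (suc a) (divOneMinusQPow a (U ⊕ oneMinusQPow* (a + a) Dk))
  four-recurrences a 1≤a {Dk} {R} {S} {S₁} {U} {E} recDk splitS recS recE N = begin
    E N                                           ≡⟨ solve-recurrence (suc a) (s≤s z≤n) {g = Dk ⊕ S₁} recE N ⟩
    divOneMinusQPow (suc a) (Dk ⊕ S₁) N           ≡⟨ divOneMinusQPow-cong (suc a) (solve-recurrence a 1≤a {g = F} recDkS₁) N ⟩
    divOneMinusQPow (suc a) (divOneMinusQPow a F) N ∎
    where
    open ≡-Reasoning
    F = U ⊕ oneMinusQPow* (a + a) Dk
    qS₁ : qPow* a S₁ ≈ qPow* a S ⊖ qPow* a R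
    qS₁ n = trans (qPow*-cong a (difference {S} {R} {S₁} splitS) n) (qPow*-⊖ a S R n)
    S₁≈ : S₁ ≈ U ⊕ qPow* a S
    S₁≈ n = trans (difference {S} {R} {S₁} splitS n) (trans (cong (ℤ._- R n) (recS n)) (cancel (R n) (U n) (qPow* a S n)))
      where
      cancel : ∀ r u x → ((r ℤ.+ u) ℤ.+ x) ℤ.- r ≡ u ℤ.+ x
      cancel = solve-∀
    qqDk : qPow* (a + a) Dk ≈ qPow* a Dk ⊖ qPow* a R
    qqDk n = trans (sym (qPow*-qPow* a a Dk n))
                   (trans (qPow*-cong a (difference {Dk} {R} {qPow* a Dk} recDk) n) (qPow*-⊖ a Dk R n))
    recDkS₁ : Dk ⊕ S₁ ≈ F ⊕ qPow* a (Dk ⊕ S₁)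
    recDkS₁ n = begin
      Dk n ℤ.+ S₁ n
        ≡⟨ cong (λ x → Dk n ℤ.+ x) (S₁≈ n) ⟩
      Dk n ℤ.+ (U n ℤ.+ qPow* a S n)
        ≡⟨ rearrange (Dk n) (U n) (qPow* a S n) (qPow* a Dk n) (qPow* a R n) ⟩
      (U n ℤ.+ (Dk n ℤ.- (qPow* a Dk n ℤ.- qPow* a R n))) ℤ.+ (qPow* a Dk n ℤ.+ (qPow* a S n ℤ.- qPow* a R n))
        ≡⟨ cong₂ (λ x y → (U n ℤ.+ (Dk n ℤ.- x)) ℤ.+ (qPow* a Dk n ℤ.+ y)) (sym (qqDk n)) (sym (qS₁ n)) ⟩
      (U n ℤ.+ (Dk n ℤ.- qPow* (a + a) Dk n)) ℤ.+ (qPow* a Dk n ℤ.+ qPow* a S₁ n)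
        ≡⟨ cong (λ x → F n ℤ.+ x) (qPow*-⊕ a Dk S₁ n) ⟨
      F n ℤ.+ qPow* a (Dk ⊕ S₁) n ∎
      where
      rearrange : ∀ d u qs qd qr → d ℤ.+ (u ℤ.+ qs) ≡ (u ℤ.+ (d ℤ.- (qd ℤ.- qr))) ℤ.+ (qd ℤ.+ (qs ℤ.- qr))
      rearrange = solve-∀


module Vectors where
  open import Data.Nat using (ℕ; zero; suc; _+_; _≤_; _≥_; _<_; _≤?_; z≤n; s≤s; pred)
  import Data.Nat.Properties as ℕP
  open import Algebra.Properties.CommutativeSemigroup ℕP.+-commutativeSemigroup
    using () renaming (x∙yz≈y∙xz to +-swap)
  open import Data.Fin as Fin using (Fin; toℕ)
  open import Data.Vec using (Vec; []; _∷_; _++_; _∷ʳ_; sum; map; lookup; take; drop; reverse)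
  open import Data.Vec.Properties using (map-∘; map-id; take++drop≡id; sum-++; reverse-∷; reverse-involutive)
  open import Data.Vec.Relation.Unary.All using (All; []; _∷_)
  import Data.Vec.Relation.Unary.All.Properties as AllP
  open import Data.Vec.Relation.Unary.Linked as Linked using (Linked; []; [-]; _∷_)
  import Data.Vec.Relation.Unary.Linked.Properties as LinkedP
  open import Data.Unit using (⊤; tt)
  open import Data.Product using (_×_; _,_)
  open import Function.Bundles using (_⇔_; mk⇔; Equivalence)
  open import Function.Construct.Composition using (_⇔-∘_)
  open import Function.Construct.Identity using (⇔-id)
  open import Function.Construct.Symmetry using (⇔-sym)
  open import Relation.Unary using (Decidable)
  open import Relation.Binary using (_Preserves_⟶_)
  open import Relation.Binary.PropositionalEquality
  open Equivalence using (to; from)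

  sum-map-suc : ∀ {n} (σ : Vec ℕ n) → sum (map suc σ) ≡ n + sum σ
  sum-map-suc []      = refl
  sum-map-suc (x ∷ σ) = cong suc (trans (cong (x +_) (sum-map-suc σ)) (+-swap x _ (sum σ)))

  map-pred-suc : ∀ {n} (σ : Vec ℕ n) → map pred (map suc σ) ≡ σ
  map-pred-suc σ = trans (sym (map-∘ pred suc σ)) (map-id σ)

  map-suc-pred : ∀ {n} {σ : Vec ℕ n} → All (1 ≤_) σ → map suc (map pred σ) ≡ σ
  map-suc-pred []               = refl
  map-suc-pred (s≤s z≤n ∷ pos) = cong (_ ∷_) (map-suc-pred pos)

  -- Weakly increasing vectors (chains read from the top of the poset downwards).
  Ascending : ∀ {n} → Vec ℕ n → Set
  Ascending = Linked _≤_

  ascending? : ∀ {n} → Decidable (Ascending {n})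
  ascending? = Linked.linked? _≤?_

  ascending-map : ∀ {n} {f} → f Preserves _≤_ ⟶ _≤_ → {c : Vec ℕ n} → Ascending c → Ascending (map f c)
  ascending-map mono asc = LinkedP.map⁺ (Linked.map mono asc)

  ascending-bounded : ∀ {n b x} {c : Vec ℕ n} → Ascending (x ∷ c) → b ≤ x → All (b ≤_) (x ∷ c)
  ascending-bounded asc b≤x = LinkedP.Linked⇒All ℕP.≤-trans b≤x asc

  ascending-cons-zero : ∀ {n} {c : Vec ℕ n} → Ascending c → Ascending (0 ∷ c)
  ascending-cons-zero []        = [-]
  ascending-cons-zero [-]       = z≤n ∷ [-]
  ascending-cons-zero (l ∷ asc) = z≤n ∷ l ∷ asc

  all-take-drop : ∀ j {n} {P : ℕ → Set} (r : Vec ℕ (j + n)) → All P (take j r) → All P (drop j r) → All P r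
  all-take-drop j r pt pd = subst (All _) (take++drop≡id j r) (AllP.++⁺ pt pd)

  take-++ : ∀ {j n} (xs : Vec ℕ j) (ys : Vec ℕ n) → take j (xs ++ ys) ≡ xs
  take-++ []       ys = refl
  take-++ (x ∷ xs) ys = cong (x ∷_) (take-++ xs ys)

  drop-++ : ∀ {j n} (xs : Vec ℕ j) (ys : Vec ℕ n) → drop j (xs ++ ys) ≡ ys
  drop-++ []       ys = refl
  drop-++ (x ∷ xs) ys = drop-++ xs ys

  onFront onBack : ∀ j {n} → (ℕ → ℕ) → Vec ℕ (j + n) → Vec ℕ (j + n)
  onFront j f r = map f (take j r) ++ drop j r
  onBack  j f r = take j r ++ map f (drop j r)

  sum-take-drop : ∀ j {n} (r : Vec ℕ (j + n)) → sum (take j r) + sum (drop j r) ≡ sum r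
  sum-take-drop j r = trans (sym (sum-++ (take j r))) (cong sum (take++drop≡id j r))

  sum-onFront : ∀ j {n} (r : Vec ℕ (j + n)) → sum (onFront j suc r) ≡ j + sum r
  sum-onFront j r = begin
    sum (map suc (take j r) ++ drop j r)      ≡⟨ sum-++ (map suc (take j r)) ⟩
    sum (map suc (take j r)) + sum (drop j r) ≡⟨ cong (_+ sum (drop j r)) (sum-map-suc (take j r)) ⟩
    (j + sum (take j r)) + sum (drop j r)     ≡⟨ ℕP.+-assoc j _ _ ⟩
    j + (sum (take j r) + sum (drop j r))     ≡⟨ cong (j +_) (sum-take-drop j r) ⟩
    j + sum r                                 ∎
    where open ≡-Reasoning

  sum-onBack : ∀ j {n} (r : Vec ℕ (j + n)) → sum (onBack j suc r) ≡ n + sum r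
  sum-onBack j {n} r = begin
    sum (take j r ++ map suc (drop j r))      ≡⟨ sum-++ (take j r) ⟩
    sum (take j r) + sum (map suc (drop j r)) ≡⟨ cong (sum (take j r) +_) (sum-map-suc (drop j r)) ⟩
    sum (take j r) + (n + sum (drop j r))     ≡⟨ +-swap (sum (take j r)) n _ ⟩
    n + (sum (take j r) + sum (drop j r))     ≡⟨ cong (n +_) (sum-take-drop j r) ⟩
    n + sum r                                 ∎
    where
    open ≡-Reasoning

  onFront-lower-raise : ∀ j {n} (r : Vec ℕ (j + n)) → onFront j pred (onFront j suc r) ≡ r
  onFront-lower-raise j r
    rewrite take-++ (map suc (take j r)) (drop j r) | drop-++ (map suc (take j r)) (drop j r)
          | map-pred-suc (take j r) = take++drop≡id j r

  onFront-raise-lower : ∀ j {n} (r : Vec ℕ (j + n)) → All (1 ≤_) (take j r) → onFront j suc (onFront j pred r) ≡ r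
  onFront-raise-lower j r pos
    rewrite take-++ (map pred (take j r)) (drop j r) | drop-++ (map pred (take j r)) (drop j r)
          | map-suc-pred pos = take++drop≡id j r

  onBack-lower-raise : ∀ j {n} (r : Vec ℕ (j + n)) → onBack j pred (onBack j suc r) ≡ r
  onBack-lower-raise j r
    rewrite take-++ (take j r) (map suc (drop j r)) | drop-++ (take j r) (map suc (drop j r))
          | map-pred-suc (drop j r) = take++drop≡id j r

  onBack-raise-lower : ∀ j {n} (r : Vec ℕ (j + n)) → All (1 ≤_) (drop j r) → onBack j suc (onBack j pred r) ≡ r
  onBack-raise-lower j r pos
    rewrite take-++ (take j r) (map pred (drop j r)) | drop-++ (take j r) (map pred (drop j r))
          | map-suc-pred pos = take++drop≡id j r

  -- Weakly decreasing vectors: a chain of a poset listed from its bottom up.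
  Descending : ∀ {n} → Vec ℕ n → Set
  Descending = Linked _≥_

  -- Antitone in the index: the form in which the chain z₋ₖ < ⋯ < z_m enters D_{m,k}.
  Antitone : ∀ {n} → Vec ℕ n → Set
  Antitone {n} c = ∀ (s t : Fin n) → toℕ s ≤ toℕ t → lookup c t ≤ lookup c s

  antitone⇔descending : ∀ {n} (c : Vec ℕ n) → Antitone c ⇔ Descending c
  antitone⇔descending c = mk⇔ (forth c) (back c)
    where
    forth : ∀ {n} (c : Vec ℕ n) → Antitone c → Descending c
    forth []          _ = []
    forth (x ∷ [])    _ = [-]
    forth (x ∷ y ∷ c) a = a Fin.zero (Fin.suc Fin.zero) z≤n ∷ forth (y ∷ c) (λ s t s≤t → a (Fin.suc s) (Fin.suc t) (s≤s s≤t))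
    back : ∀ {n} (c : Vec ℕ n) → Descending c → Antitone c
    back (x ∷ c) desc Fin.zero    t           _         =
      AllP.lookup⁺ (LinkedP.Linked⇒All (λ y≥x x≥z → ℕP.≤-trans x≥z y≥x) ℕP.≤-refl desc) t
    back (x ∷ c) desc (Fin.suc s) (Fin.suc t) (s≤s s≤t) = back c (Linked.tail desc) s t s≤t

  OnLast : ∀ {n} → (ℕ → Set) → Vec ℕ n → Set
  OnLast P []          = ⊤
  OnLast P (x ∷ [])    = P x
  OnLast P (x ∷ y ∷ c) = OnLast P (y ∷ c)

  AtIndex : ∀ {n} → Vec ℕ n → ℕ → (ℕ → Set) → Set
  AtIndex []      K       P = ⊤
  AtIndex (x ∷ c) zero    P = P x
  AtIndex (x ∷ c) (suc K) P = AtIndex c K P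

  atIndex-∷ʳ-last : ∀ {n} (c : Vec ℕ n) x P → AtIndex (c ∷ʳ x) n P ⇔ P x
  atIndex-∷ʳ-last []      x P = ⇔-id _
  atIndex-∷ʳ-last (y ∷ c) x P = atIndex-∷ʳ-last c x P

  atIndex-∷ʳ-init : ∀ {n K} (c : Vec ℕ n) x P → K < n → AtIndex (c ∷ʳ x) K P ⇔ AtIndex c K P
  atIndex-∷ʳ-init {K = zero}  (y ∷ c) x P _         = ⇔-id _
  atIndex-∷ʳ-init {K = suc K} (y ∷ c) x P (s≤s K<n) = atIndex-∷ʳ-init c x P K<n

  atIndex-reverse-first : ∀ {n} x (w : Vec ℕ n) P → AtIndex (reverse (x ∷ w)) n P ⇔ P x
  atIndex-reverse-first x w P rewrite reverse-∷ x w = atIndex-∷ʳ-last (reverse w) x P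

  atIndex-reverse-second : ∀ {n} x y (w : Vec ℕ n) P → AtIndex (reverse (x ∷ y ∷ w)) n P ⇔ P y
  atIndex-reverse-second x y w P rewrite reverse-∷ x (y ∷ w) =
    atIndex-reverse-first y w P ⇔-∘ atIndex-∷ʳ-init (reverse (y ∷ w)) x P ℕP.≤-refl

  atIndex0-reverse : ∀ {n} (c : Vec ℕ n) P → AtIndex (reverse c) 0 P ⇔ OnLast P c
  atIndex0-reverse []          P = mk⇔ (λ _ → tt) (λ _ → tt)
  atIndex0-reverse (x ∷ [])    P = ⇔-id _
  atIndex0-reverse (x ∷ y ∷ c) P =
    subst (λ d → AtIndex d 0 P ⇔ OnLast P (y ∷ c)) (sym (reverse-∷ x (y ∷ c)))
          (atIndex0-reverse (y ∷ c) P ⇔-∘ atIndex-∷ʳ-init (reverse (y ∷ c)) x P (s≤s z≤n))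

  onLast-reverse : ∀ {n} (c : Vec ℕ n) P → OnLast P (reverse c) ⇔ AtIndex c 0 P
  onLast-reverse c P = ⇔-sym (subst (λ d → AtIndex d 0 P ⇔ OnLast P (reverse c)) (reverse-involutive c)
                                    (atIndex0-reverse (reverse c) P))

  linked-∷ : ∀ {n} {R : ℕ → ℕ → Set} x (c : Vec ℕ n) → Linked R (x ∷ c) ⇔ (Linked R c × AtIndex c 0 (R x))
  linked-∷ x []      = mk⇔ (λ _ → [] , tt) (λ _ → [-])
  linked-∷ x (y ∷ c) = mk⇔ (λ l → Linked.tail l , Linked.head l) (λ (l , r) → r ∷ l)

  linked-∷ʳ : ∀ {n} {R : ℕ → ℕ → Set} (c : Vec ℕ n) x → Linked R (c ∷ʳ x) ⇔ (Linked R c × OnLast (λ y → R y x) c)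
  linked-∷ʳ {R = R} c x = mk⇔ (forth c) (back c)
    where
    forth : ∀ {n} (c : Vec ℕ n) → Linked R (c ∷ʳ x) → Linked R c × OnLast (λ y → R y x) c
    forth []          _         = [] , tt
    forth (y ∷ [])    (r ∷ [-]) = [-] , r
    forth (y ∷ z ∷ c) (r ∷ l)   = let (l′ , last) = forth (z ∷ c) l in r ∷ l′ , last
    back : ∀ {n} (c : Vec ℕ n) → Linked R c × OnLast (λ y → R y x) c → Linked R (c ∷ʳ x)
    back []          _                = [-]
    back (y ∷ [])    (_ , r)          = r ∷ [-]
    back (y ∷ z ∷ c) (r ∷ l′ , last) = r ∷ back (z ∷ c) (l′ , last)

  descending⇔ascending-reverse : ∀ {n} (c : Vec ℕ n) → Descending c ⇔ Ascending (reverse c)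
  descending⇔ascending-reverse []      = mk⇔ (λ _ → []) (λ _ → [])
  descending⇔ascending-reverse (x ∷ c) = subst (λ d → Descending (x ∷ c) ⇔ Ascending d) (sym (reverse-∷ x c)) (mk⇔
    (λ d → let (dc , hd) = to (linked-∷ x c) d in
           from (linked-∷ʳ (reverse c) x) (to (descending⇔ascending-reverse c) dc , from (onLast-reverse c (_≤ x)) hd))
    (λ a → let (ac , lst) = to (linked-∷ʳ (reverse c) x) a in
           from (linked-∷ x c) (from (descending⇔ascending-reverse c) ac , to (onLast-reverse c (_≤ x)) lst)))

  linked-++ : ∀ {m n} {R : ℕ → ℕ → Set} (xs : Vec ℕ m) (ys : Vec ℕ n) →
    Linked R (xs ++ ys) ⇔ (Linked R xs × Linked R ys × OnLast (λ x → AtIndex ys 0 (R x)) xs)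
  linked-++ {R = R} xs ys = mk⇔ (forth xs) (back xs)
    where
    forth : ∀ {m} (xs : Vec ℕ m) → Linked R (xs ++ ys) → Linked R xs × Linked R ys × OnLast (λ x → AtIndex ys 0 (R x)) xs
    forth []           l       = [] , l , tt
    forth (x ∷ [])     l       = let (l′ , r) = to (linked-∷ x ys) l in [-] , l′ , r
    forth (x ∷ y ∷ xs) (r ∷ l) = let (a , b , c) = forth (y ∷ xs) l in r ∷ a , b , c
    back : ∀ {m} (xs : Vec ℕ m) → Linked R xs × Linked R ys × OnLast (λ x → AtIndex ys 0 (R x)) xs → Linked R (xs ++ ys)
    back []           (_ , l , _)     = l
    back (x ∷ [])     (_ , l , r)     = from (linked-∷ x ys) (l , r)
    back (x ∷ y ∷ xs) (r ∷ a , b , c) = r ∷ back (y ∷ xs) (a , b , c)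

  atIndex⇔lookup : ∀ {n} (c : Vec ℕ n) K P → (∀ t → toℕ t ≡ K → P (lookup c t)) ⇔ AtIndex c K P
  atIndex⇔lookup c K P = mk⇔ (forth c K) (back c K)
    where
    forth : ∀ {n} (c : Vec ℕ n) K → (∀ t → toℕ t ≡ K → P (lookup c t)) → AtIndex c K P
    forth []      K       _ = tt
    forth (x ∷ c) zero    f = f Fin.zero refl
    forth (x ∷ c) (suc K) f = forth c K (λ t eq → f (Fin.suc t) (cong suc eq))
    back : ∀ {n} (c : Vec ℕ n) K → AtIndex c K P → ∀ t → toℕ t ≡ K → P (lookup c t)
    back (x ∷ c) zero    px Fin.zero    refl = px
    back (x ∷ c) (suc K) a  (Fin.suc t) eq   = back c K a t (ℕP.suc-injective eq)

  atIndex-++ˡ : ∀ {m n K} (xs : Vec ℕ m) (ys : Vec ℕ n) P → K < m → AtIndex (xs ++ ys) K P ⇔ AtIndex xs K P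
  atIndex-++ˡ {K = zero}  (x ∷ xs) ys P _         = ⇔-id _
  atIndex-++ˡ {K = suc K} (x ∷ xs) ys P (s≤s K<m) = atIndex-++ˡ xs ys P K<m

  atIndex-++-boundary : ∀ {m n} (xs : Vec ℕ m) (ys : Vec ℕ n) P → AtIndex (xs ++ ys) m P ⇔ AtIndex ys 0 P
  atIndex-++-boundary []       ys P = ⇔-id _
  atIndex-++-boundary (x ∷ xs) ys P = atIndex-++-boundary xs ys P

  sum-reverse : ∀ {n} (c : Vec ℕ n) → sum (reverse c) ≡ sum c
  sum-reverse []      = refl
  sum-reverse (x ∷ c) = begin
    sum (reverse (x ∷ c))  ≡⟨ cong sum (reverse-∷ x c) ⟩
    sum (reverse c ∷ʳ x)   ≡⟨ sum-∷ʳ (reverse c) ⟩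
    sum (reverse c) + x    ≡⟨ cong (_+ x) (sum-reverse c) ⟩
    sum c + x              ≡⟨ ℕP.+-comm (sum c) x ⟩
    x + sum c              ∎
    where
    open ≡-Reasoning
    sum-∷ʳ : ∀ {n} (d : Vec ℕ n) → sum (d ∷ʳ x) ≡ sum d + x
    sum-∷ʳ []      = ℕP.+-comm x 0
    sum-∷ʳ (y ∷ d) = trans (cong (y +_) (sum-∷ʳ d)) (sym (ℕP.+-assoc y (sum d) x))

  descending-reverse⇔ascending : ∀ {n} (w : Vec ℕ n) → Descending (reverse w) ⇔ Ascending w
  descending-reverse⇔ascending w =
    subst (λ d → Descending (reverse w) ⇔ Ascending d) (reverse-involutive w) (descending⇔ascending-reverse (reverse w))

module Recurrences where
  open Counting
  open Series
  open Vectors using (sum-map-suc; map-pred-suc; map-suc-pred)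
  open import Defs using (PS; _⊕_; qPow*; toPS)
  import Data.Integer as ℤ
  open import Data.Nat as ℕ using (ℕ; zero; suc; _+_; _∸_; _≤_; _≤?_; z≤n; s≤s; pred)
  import Data.Nat.Properties as ℕP
  open import Algebra.Properties.CommutativeSemigroup ℕP.+-commutativeSemigroup
    using () renaming (x∙yz≈y∙xz to +-swap)
  open import Data.Fin as Fin using (Fin)
  open import Data.Vec using (Vec; _∷_; sum; map; lookup; insertAt; removeAt)
  open import Data.Vec.Properties using (lookup-map; insertAt-lookup; insertAt-removeAt; removeAt-insertAt)
  import Data.Integer.Properties as ℤP
  open import Data.Vec.Relation.Unary.All using (All; _∷_)
  open import Data.Product using (_×_; _,_; proj₁; proj₂)
  open import Relation.Nullary using (yes; no)
  open import Data.Empty using (⊥-elim)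
  open import Relation.Unary using (Pred; Decidable; _∩_; ∁)
  open import Relation.Unary.Properties using (_∩?_; ∁?)
  open import Relation.Binary using (_Preserves_⟶_)
  open import Relation.Binary.PropositionalEquality

  series : ∀ {n} {P : Pred (Vec ℕ n) 0ℓ} → Decidable P → PS
  series P? = toPS (count P?)

  count-shift : ∀ {n} {P Q : Pred (Vec ℕ n) 0ℓ} (P? : Decidable P) (Q? : Decidable Q) w
    (lower raise : Vec ℕ n → Vec ℕ n) →
    (∀ τ → sum (raise τ) ≡ w + sum τ) →
    (∀ τ → P τ → (P (raise τ) × Q (raise τ)) × lower (raise τ) ≡ τ) →
    (∀ σ → P σ → Q σ → P (lower σ) × raise (lower σ) ≡ σ) →
    series (P? ∩? Q?) ≈ qPow* w (series P?)
  count-shift {P = P} {Q} P? Q? w lower raise sum-raise up down N with w ≤? N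
  ... | yes w≤N = trans (cong ℤ.+_ (count-bijection (P? ∩? Q?) P? {g = lower} {raise} lowering raising))
                        (sym (qPow*-≤ (series P?) w≤N))
    where
    sum-lower : ∀ σ → P σ → Q σ → w + sum (lower σ) ≡ sum σ
    sum-lower σ pσ qσ = trans (sym (sum-raise (lower σ))) (cong sum (proj₂ (down σ pσ qσ)))
    lowering : Transfers (P ∩ Q) N P (N ∸ w) lower raise
    lowering σ (pσ , qσ) sσ =
      proj₁ (down σ pσ qσ) ,
      ℕP.+-cancelˡ-≡ w _ _ (trans (sum-lower σ pσ qσ) (trans sσ (sym (ℕP.m+[n∸m]≡n w≤N)))) ,
      proj₂ (down σ pσ qσ)
    raising : Transfers P (N ∸ w) (P ∩ Q) N raise lower
    raising τ pτ sτ = proj₁ (up τ pτ) , trans (sum-raise τ) (trans (cong (λ x → w + x) sτ) (ℕP.m+[n∸m]≡n w≤N)) , proj₂ (up τ pτ)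
  ... | no w≰N = trans (cong ℤ.+_ (count-none (P? ∩? Q?) N tooSmall)) (sym (qPow*-≰ (series P?) w≰N))
    where
    tooSmall : ∀ σ → (P ∩ Q) σ → sum σ ≢ N
    tooSmall σ (pσ , qσ) sσ =
      w≰N (subst (w ≤_) (trans (sym (sum-raise (lower σ))) (trans (cong sum (proj₂ (down σ pσ qσ))) sσ)) (ℕP.m≤m+n w _))

  series-split : ∀ {n} {P R : Pred (Vec ℕ n) 0ℓ} (P? : Decidable P) (R? : Decidable R) →
    series P? ≈ series (P? ∩? R?) ⊕ series (P? ∩? ∁? R?)
  series-split P? R? N = trans (cong ℤ.+_ (count-split P? R? N)) (ℤP.pos-+ (count (P? ∩? R?) N) (count (P? ∩? ∁? R?) N))

  first : ∀ {n} → Fin (suc n)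
  first = Fin.zero

  second : ∀ {n} → Fin (suc (suc n))
  second = Fin.suc Fin.zero

  ZeroAt : ∀ {n} → Fin n → Pred (Vec ℕ n) 0ℓ
  ZeroAt i σ = lookup σ i ≡ 0

  ZeroAt? : ∀ {n} (i : Fin n) → Decidable (ZeroAt i)
  ZeroAt? i σ = lookup σ i ℕ.≟ 0

  sum-insertAt : ∀ {n} (τ : Vec ℕ n) i x → sum (insertAt τ i x) ≡ x + sum τ
  sum-insertAt τ       Fin.zero    x = refl
  sum-insertAt (y ∷ τ) (Fin.suc i) x = trans (cong (y +_) (sum-insertAt τ i x)) (+-swap y x (sum τ))

  count-zeroAt : ∀ {n} {P : Pred (Vec ℕ (suc n)) 0ℓ} {Q : Pred (Vec ℕ n) 0ℓ}
    (P? : Decidable P) (Q? : Decidable Q) (i : Fin (suc n)) →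
    (∀ τ → P (insertAt τ i 0) → Q τ) → (∀ τ → Q τ → P (insertAt τ i 0)) →
    series (P? ∩? ZeroAt? i) ≈ series Q?
  count-zeroAt {P = P} {Q} P? Q? i P⇒Q Q⇒P N =
    cong ℤ.+_ (count-bijection (P? ∩? ZeroAt? i) Q? {g = λ σ → removeAt σ i} {h = λ τ → insertAt τ i 0} remove insert)
    where
    refill : ∀ σ → ZeroAt i σ → insertAt (removeAt σ i) i 0 ≡ σ
    refill σ σᵢ≡0 = trans (cong (insertAt (removeAt σ i) i) (sym σᵢ≡0)) (insertAt-removeAt σ i)
    remove : Transfers (P ∩ ZeroAt i) N Q N (λ σ → removeAt σ i) (λ τ → insertAt τ i 0)
    remove σ (pσ , σᵢ≡0) sσ =
      P⇒Q _ (subst P (sym (refill σ σᵢ≡0)) pσ) ,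
      trans (sym (sum-insertAt (removeAt σ i) i 0)) (trans (cong sum (refill σ σᵢ≡0)) sσ) ,
      refill σ σᵢ≡0
    insert : Transfers Q N (P ∩ ZeroAt i) N (λ τ → insertAt τ i 0) (λ σ → removeAt σ i)
    insert τ qτ sτ = (Q⇒P τ qτ , insertAt-lookup τ i 0) , trans (sum-insertAt τ i 0) sτ , removeAt-insertAt τ i 0

  -- P is insensitive to monotone relabelling of the entries (true of any
  -- predicate built from inequalities between entries).
  MonotoneStable : ∀ {n} → Pred (Vec ℕ n) 0ℓ → Set
  MonotoneStable P = ∀ f → f Preserves _≤_ ⟶ _≤_ → ∀ σ → P σ → P (map f σ)

  count-allPositive : ∀ {n} {P Q : Pred (Vec ℕ n) 0ℓ} (P? : Decidable P) (Q? : Decidable Q) →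
    MonotoneStable P → (∀ σ → Q (map suc σ)) → (∀ σ → P σ → Q σ → All (1 ≤_) σ) →
    series (P? ∩? Q?) ≈ qPow* n (series P?)
  count-allPositive {n} P? Q? stable Q-raised positive =
    count-shift P? Q? n (map pred) (map suc) sum-map-suc
      (λ τ pτ → (stable suc s≤s τ pτ , Q-raised τ) , map-pred-suc τ)
      (λ σ pσ qσ → stable pred ℕP.pred-mono-≤ σ pσ , map-suc-pred (positive σ pσ qσ))

  raised-nonzero : ∀ {n} (i : Fin n) σ → ∁ (ZeroAt i) (map suc σ)
  raised-nonzero i σ eq with () ← trans (sym (lookup-map i suc σ)) eq

  nonzero⇒positive : ∀ {x} → x ≢ 0 → 1 ≤ x
  nonzero⇒positive {zero}  x≢0 = ⊥-elim (x≢0 refl)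
  nonzero⇒positive {suc x} _   = s≤s z≤n

  -- Peeling a minimal entry: if the first entry of a P-vector is a lower bound
  -- for all of it, then either it is 0 or all entries drop by 1:  P = P[σ₀ = 0] + q^n P.
  peel-first : ∀ {n} {P : Pred (Vec ℕ (suc n)) 0ℓ} (P? : Decidable P) → MonotoneStable P →
    (∀ σ → P σ → 1 ≤ lookup σ first → All (1 ≤_) σ) →
    series P? ≈ series (P? ∩? ZeroAt? first) ⊕ qPow* (suc n) (series P?)
  peel-first P? stable positive N =
    trans (series-split P? (ZeroAt? first) N)
          (cong (λ x → series (P? ∩? ZeroAt? first) N ℤ.+ x)
                (count-allPositive P? (∁? (ZeroAt? first)) stable (raised-nonzero first)
                   (λ σ pσ σ₀≢0 → positive σ pσ (nonzero⇒positive σ₀≢0)) N))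

  peel-second : ∀ {n} {P : Pred (Vec ℕ (suc (suc n))) 0ℓ} (P? : Decidable P) → MonotoneStable P →
    (∀ σ → P σ → 1 ≤ lookup σ first → 1 ≤ lookup σ (second) → All (1 ≤_) σ) →
    series (P? ∩? ∁? (ZeroAt? first)) ≈
      toPS (count ((P? ∩? ∁? (ZeroAt? first)) ∩? ZeroAt? (second))) ⊕ qPow* (suc (suc n)) (series P?)
  peel-second {P = P} P? stable positive N =
    trans (series-split P′? (ZeroAt? second) N)
          (cong (λ x → series (P′? ∩? ZeroAt? second) N ℤ.+ x)
                (trans (cong ℤ.+_ (count-cong (P′? ∩? ∁? (ZeroAt? second)) (P? ∩? both?) N
                                     (λ _ ((pσ , n₀) , n₁) → pσ , n₀ , n₁) (λ _ (pσ , n₀ , n₁) → (pσ , n₀) , n₁)))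
                       (count-allPositive P? both? stable (λ σ → raised-nonzero first σ , raised-nonzero second σ)
                          (λ σ pσ (n₀ , n₁) → positive σ pσ (nonzero⇒positive n₀) (nonzero⇒positive n₁)) N)))
    where
    P′? = P? ∩? ∁? (ZeroAt? first)
    both? = ∁? (ZeroAt? first) ∩? ∁? (ZeroAt? second)

-- The auxiliary posets, all built on P with top element y1 and a chosen y2,
-- for k = k′ + 1.  Each is encoded by a predicate on vectors listing its
-- values from the top of the poset downwards.
module Models {p : ℕ} (_≤P_ : Rel (Fin p) 0ℓ) (_≤P?_ : ∀ a b → Dec (a ≤P b))
            (y1 y2 : Fin p) (below-y1 : ∀ a → a ≤P y1) (k′ : ℕ) where
  open Counting
  open Series
  open Recurrences
  open Vectors
  open import Defs using (_⊕_; qPow*; IsPartition)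
  open import Data.Nat using (ℕ; zero; suc; _+_; _≤_; _≤?_; z≤n; s≤s; pred)
  import Data.Nat.Properties as ℕP
  open import Algebra.Properties.CommutativeSemigroup ℕP.+-commutativeSemigroup
    using () renaming (x∙yz≈y∙xz to +-swap)
  open import Data.Fin using (Fin)
  import Data.Fin.Properties as FinP
  open import Data.Vec as Vec using (Vec; _∷_; sum; map; lookup; take; drop; _++_)
  open import Data.Vec.Properties using (take-map; drop-map; lookup-map)
  open import Data.Vec.Relation.Unary.All using (All; _∷_)
  import Data.Vec.Relation.Unary.All as All
  import Data.Vec.Relation.Unary.All.Properties as AllP
  open import Data.Vec.Relation.Unary.Linked as Linked using (Linked)
  open import Data.Product using (_×_; _,_; proj₁)
  open import Relation.Nullary using (Dec)
  open import Data.Empty using (⊥-elim)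
  open import Relation.Nullary.Decidable using (_×-dec_; _→-dec_)
  open import Relation.Unary using (Pred; Decidable; _∩_; ∁)
  open import Relation.Unary.Properties using (_∩?_; ∁?)
  open import Relation.Binary using (Rel; _Preserves_⟶_)
  open import Relation.Binary.PropositionalEquality

  Partition : Pred (Vec ℕ p) 0ℓ
  Partition = IsPartition _≤P_

  partition? : Decidable Partition
  partition? π = FinP.all? λ a → FinP.all? λ b → (a ≤P? b) →-dec (lookup π b ≤? lookup π a)

  partition-map : ∀ {f} → f Preserves _≤_ ⟶ _≤_ → ∀ π → Partition π → Partition (map f π)
  partition-map {f} mono π pπ a b a≤b rewrite lookup-map a f π | lookup-map b f π = mono (pπ a b a≤b)

  β γ : Vec ℕ p → ℕ
  β π = lookup π y1
  γ π = lookup π y2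

  β-map : ∀ f π → β (map f π) ≡ f (β π)
  β-map f π = lookup-map y1 f π

  -- y1 is the top of P, so its value is the smallest.
  partition-bounded : ∀ {b} π → Partition π → b ≤ β π → All (b ≤_) π
  partition-bounded π pπ b≤β = AllP.lookup⁻ (λ a → ℕP.≤-trans b≤β (pπ a y1 (below-y1 a)))

  -- R = P ∪ {z₋₁ > ⋯ > z₋ₖ} with z₋₁ > y2; vectors  z₋₁ ∷ (z₋₂ … z₋ₖ) ++ π.
  nR : ℕ
  nR = suc (k′ + p)

  R : Pred (Vec ℕ nR) 0ℓ
  R (z ∷ r) = Ascending (z ∷ take k′ r) × Partition (drop k′ r) × z ≤ γ (drop k′ r)

  R? : Decidable R
  R? (z ∷ r) = ascending? (z ∷ take k′ r) ×-dec partition? (drop k′ r) ×-dec (z ≤? γ (drop k′ r))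

  βR : Vec ℕ nR → ℕ
  βR (z ∷ r) = β (drop k′ r)

  βR-map : ∀ f σ → βR (map f σ) ≡ f (βR σ)
  βR-map f (z ∷ r) = trans (cong β (drop-map f k′ r)) (β-map f (drop k′ r))

  R-stable : MonotoneStable R
  R-stable f mono (z ∷ r) (asc , pπ , z≤γ)
    rewrite take-map f k′ r | drop-map f k′ r | lookup-map y2 f (drop k′ r) =
    ascending-map mono asc , partition-map mono (drop k′ r) pπ , mono z≤γ

  -- The minimal values of an R-vector sit at z₋₁ and y1.
  R-bounded : ∀ {b} σ → R σ → b ≤ Vec.head σ → b ≤ βR σ → All (b ≤_) σ
  R-bounded (z ∷ r) (asc , pπ , _) b≤z b≤β with ascending-bounded asc b≤z
  ... | b≤z′ ∷ chain = b≤z′ ∷ all-take-drop k′ r chain (partition-bounded (drop k′ r) pπ b≤β)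

  -- D_k(P) = R ∪ {z₀} with z₀ above z₋₁ and y1; vectors  z₀ ∷ R-vector.
  Dk : Pred (Vec ℕ (suc nR)) 0ℓ
  Dk (z₀ ∷ σ) = R σ × z₀ ≤ Vec.head σ × z₀ ≤ βR σ

  Dk? : Decidable Dk
  Dk? (z₀ ∷ σ) = R? σ ×-dec (z₀ ≤? Vec.head σ) ×-dec (z₀ ≤? βR σ)

  head-map : ∀ {n} (f : ℕ → ℕ) (σ : Vec ℕ (suc n)) → Vec.head (map f σ) ≡ f (Vec.head σ)
  head-map f (x ∷ σ) = refl

  Dk-stable : MonotoneStable Dk
  Dk-stable f mono (z₀ ∷ σ) (rσ , z₀≤z , z₀≤β) =
    R-stable f mono σ rσ ,
    subst (f z₀ ≤_) (sym (head-map f σ)) (mono z₀≤z) ,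
    subst (f z₀ ≤_) (sym (βR-map f σ)) (mono z₀≤β)

  -- z₀ is the top of D_k(P).
  Dk-bounded : ∀ {b} σ → Dk σ → b ≤ lookup σ first → All (b ≤_) σ
  Dk-bounded (z₀ ∷ σ) (rσ , z₀≤z , z₀≤β) b≤z₀ =
    b≤z₀ ∷ R-bounded σ rσ (ℕP.≤-trans b≤z₀ z₀≤z) (ℕP.≤-trans b≤z₀ z₀≤β)

  -- S = R ∪ {y0} with y0 above y1 only; vectors  y0 ∷ R-vector.
  S : Pred (Vec ℕ (suc nR)) 0ℓ
  S (v ∷ σ) = R σ × v ≤ βR σ

  S? : Decidable S
  S? (v ∷ σ) = R? σ ×-dec (v ≤? βR σ)

  S-stable : MonotoneStable S
  S-stable f mono (v ∷ σ) (rσ , v≤β) = R-stable f mono σ rσ , subst (f v ≤_) (sym (βR-map f σ)) (mono v≤β)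

  S₊? : Decidable (S ∩ ∁ (ZeroAt first))
  S₊? = S? ∩? ∁? (ZeroAt? first)

  -- E = D_{0,k}(P) = D_k(P) ∪ {y0}; vectors  y0 ∷ z₀ ∷ R-vector.
  nE : ℕ
  nE = suc (suc nR)

  E : Pred (Vec ℕ nE) 0ℓ
  E (v ∷ σ) = Dk σ × v ≤ βR (Vec.tail σ)

  E? : Decidable E
  E? (v ∷ σ) = Dk? σ ×-dec (v ≤? βR (Vec.tail σ))

  E-stable : MonotoneStable E
  E-stable f mono (v ∷ z₀ ∷ σ) (dσ , v≤β) = Dk-stable f mono (z₀ ∷ σ) dσ , subst (f v ≤_) (sym (βR-map f σ)) (mono v≤β)

  -- X m = D_{m,k}(P): the chain z_m > ⋯ > z₁ on top of E, with z₁ above y0 and z₀;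
  -- vectors  z_m ∷ ⋯ ∷ z₁ ∷ E-vector.  BelowNext m t σ says that t lies
  -- above the elements it covers in the (X m)-vector σ.
  BelowNext : ∀ m → ℕ → Vec ℕ (m + nE) → Set
  BelowNext zero    t (v ∷ z₀ ∷ _) = t ≤ v × t ≤ z₀
  BelowNext (suc m) t (t′ ∷ _)     = t ≤ t′

  belowNext? : ∀ m t σ → Dec (BelowNext m t σ)
  belowNext? zero    t (v ∷ z₀ ∷ _) = (t ≤? v) ×-dec (t ≤? z₀)
  belowNext? (suc m) t (t′ ∷ _)     = t ≤? t′

  X : ∀ m → Pred (Vec ℕ (m + nE)) 0ℓ
  X zero    σ       = E σ
  X (suc m) (t ∷ σ) = X m σ × BelowNext m t σ

  X? : ∀ m → Decidable (X m)
  X? zero    σ       = E? σ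
  X? (suc m) (t ∷ σ) = X? m σ ×-dec belowNext? m t σ

  belowNext-map : ∀ {f} → f Preserves _≤_ ⟶ _≤_ → ∀ m t σ → BelowNext m t σ → BelowNext m (f t) (map f σ)
  belowNext-map mono zero    t (v ∷ z₀ ∷ _) (t≤v , t≤z₀) = mono t≤v , mono t≤z₀
  belowNext-map mono (suc m) t (t′ ∷ _)     t≤t′         = mono t≤t′

  belowNext-zero : ∀ m σ → BelowNext m 0 σ
  belowNext-zero zero    (v ∷ z₀ ∷ _) = z≤n , z≤n
  belowNext-zero (suc m) (t′ ∷ _)     = z≤n

  X-stable : ∀ m → MonotoneStable (X m)
  X-stable zero    f mono σ       eσ         = E-stable f mono σ eσ
  X-stable (suc m) f mono (t ∷ σ) (xσ , t≤) = X-stable m f mono σ xσ , belowNext-map mono m t σ t≤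

  X-bounded : ∀ m {t} σ → X m σ → BelowNext m t σ → All (t ≤_) σ
  X-bounded zero    (v ∷ z₀ ∷ σ) ((rσ , z₀≤z , z₀≤β) , v≤β) (t≤v , t≤z₀) =
    t≤v ∷ t≤z₀ ∷ R-bounded σ rσ (ℕP.≤-trans t≤z₀ z₀≤z) (ℕP.≤-trans t≤v v≤β)
  X-bounded (suc m) (t′ ∷ σ) (xσ , t′≤) t≤t′ =
    t≤t′ ∷ All.map (ℕP.≤-trans t≤t′) (X-bounded m σ xσ t′≤)

  -- W j = P⁺ ⊔ (a chain of j elements); vectors  top ∷ chain ++ π.
  W : ∀ j → Pred (Vec ℕ (suc (j + p))) 0ℓ
  W j (v ∷ r) = Ascending (take j r) × Partition (drop j r) × v ≤ β (drop j r)

  W? : ∀ j → Decidable (W j)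
  W? j (v ∷ r) = ascending? (take j r) ×-dec partition? (drop j r) ×-dec (v ≤? β (drop j r))

  U? : Decidable (W k′ ∩ ∁ (ZeroAt first))
  U? = W? k′ ∩? ∁? (ZeroAt? first)

  -- The recurrences between the counts of the models, with a = |R| + 1 = k + p + 1.
  -- D_k = D_k[z₀ = 0] + q^a D_k, and D_k[z₀ = 0] is R.
  rec-Dk : series Dk? ≈ series R? ⊕ qPow* (suc nR) (series Dk?)
  rec-Dk = begin
    series Dk?                                                    ≈⟨ peel-first Dk? Dk-stable Dk-bounded ⟩
    series (Dk? ∩? ZeroAt? first) ⊕ qPow* (suc nR) (series Dk?)   ≈⟨ ⊕-congˡ (qPow* (suc nR) (series Dk?)) top-zero ⟩
    series R? ⊕ qPow* (suc nR) (series Dk?)                       ∎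
    where
    open ≈-Reasoning
    top-zero = count-zeroAt Dk? R? first (λ τ dτ → proj₁ dτ) (λ τ rτ → rτ , z≤n , z≤n)

  -- S = S[y0 = 0] + S₊, and S[y0 = 0] is R.
  split-S : series S? ≈ series R? ⊕ series S₊?
  split-S = begin
    series S?                                      ≈⟨ series-split S? (ZeroAt? first) ⟩
    series (S? ∩? ZeroAt? first) ⊕ series S₊?
      ≈⟨ ⊕-congˡ (series S₊?) (count-zeroAt S? R? first (λ τ sτ → proj₁ sτ) (λ τ rτ → rτ , z≤n)) ⟩
    series R? ⊕ series S₊?                         ∎
    where open ≈-Reasoning

  -- S₊ = S₊[z₋₁ = 0] + q^a S, and S₊[z₋₁ = 0] is U.
  rec-S : series S? ≈ (series R? ⊕ series U?) ⊕ qPow* (suc nR) (series S?)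
  rec-S = begin
    series S?                                                ≈⟨ split-S ⟩
    series R? ⊕ series S₊?                                   ≈⟨ ⊕-congʳ (series R?) (peel-second S? S-stable S-bounded) ⟩
    series R? ⊕ (series (S₊? ∩? ZeroAt? second) ⊕ qPow* (suc nR) (series S?))
      ≈⟨ ⊕-congʳ (series R?) (⊕-congˡ (qPow* (suc nR) (series S?)) (count-zeroAt S₊? U? second S₊⇒U U⇒S₊)) ⟩
    series R? ⊕ (series U? ⊕ qPow* (suc nR) (series S?))   ≈⟨ ⊕-assoc (series R?) (series U?) (qPow* (suc nR) (series S?)) ⟨
    (series R? ⊕ series U?) ⊕ qPow* (suc nR) (series S?)   ∎
    where
    open ≈-Reasoning
    S-bounded : ∀ σ → S σ → 1 ≤ lookup σ first → 1 ≤ lookup σ second → All (1 ≤_) σ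
    S-bounded (v ∷ z ∷ r) (rσ , v≤β) 1≤v 1≤z = 1≤v ∷ R-bounded (z ∷ r) rσ 1≤z (ℕP.≤-trans 1≤v v≤β)
    S₊⇒U : ∀ τ → (S ∩ ∁ (ZeroAt first)) (Vec.insertAt τ second 0) → (W k′ ∩ ∁ (ZeroAt first)) τ
    S₊⇒U (v ∷ τ) (((asc , pπ , _) , v≤β) , v≢0) = (Linked.tail asc , pπ , v≤β) , v≢0
    U⇒S₊ : ∀ τ → (W k′ ∩ ∁ (ZeroAt first)) τ → (S ∩ ∁ (ZeroAt first)) (Vec.insertAt τ second 0)
    U⇒S₊ (v ∷ τ) ((asc , pπ , v≤β) , v≢0) = ((ascending-cons-zero asc , pπ , z≤n) , v≤β) , v≢0

  -- E = E[y0 = 0] + E₊ with E[y0 = 0] = D_k, and E₊ = E₊[z₀ = 0] + q^(a+1) E with E₊[z₀ = 0] = S₊.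
  rec-E : series E? ≈ (series Dk? ⊕ series S₊?) ⊕ qPow* nE (series E?)
  rec-E = begin
    series E?                                                        ≈⟨ series-split E? (ZeroAt? first) ⟩
    series (E? ∩? ZeroAt? first) ⊕ series E₊?
      ≈⟨ ⊕-congʳ (series (E? ∩? ZeroAt? first)) (peel-second E? E-stable E-bounded) ⟩
    series (E? ∩? ZeroAt? first) ⊕ (series (E₊? ∩? ZeroAt? second) ⊕ qPow* nE (series E?))
      ≈⟨ ⊕-congˡ (series (E₊? ∩? ZeroAt? second) ⊕ qPow* nE (series E?)) y0-zero ⟩
    series Dk? ⊕ (series (E₊? ∩? ZeroAt? second) ⊕ qPow* nE (series E?))
      ≈⟨ ⊕-congʳ (series Dk?) (⊕-congˡ (qPow* nE (series E?)) z₀-zero) ⟩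
    series Dk? ⊕ (series S₊? ⊕ qPow* nE (series E?))                 ≈⟨ ⊕-assoc (series Dk?) (series S₊?) (qPow* nE (series E?)) ⟨
    (series Dk? ⊕ series S₊?) ⊕ qPow* nE (series E?)                 ∎
    where
    open ≈-Reasoning
    E₊? = E? ∩? ∁? (ZeroAt? first)
    E-bounded : ∀ σ → E σ → 1 ≤ lookup σ first → 1 ≤ lookup σ second → All (1 ≤_) σ
    E-bounded (v ∷ z₀ ∷ σ) eσ 1≤v 1≤z₀ = X-bounded zero (v ∷ z₀ ∷ σ) eσ (1≤v , 1≤z₀)
    y0-zero = count-zeroAt E? Dk? first (λ τ eτ → proj₁ eτ) (λ τ dτ → dτ , z≤n)
    z₀-zero = count-zeroAt E₊? S₊? second
      (λ { (v ∷ τ) (((rτ , _ , _) , v≤β) , v≢0) → (rτ , v≤β) , v≢0 })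
      (λ { (v ∷ τ) ((rτ , v≤β) , v≢0) → ((rτ , z≤n , z≤n) , v≤β) , v≢0 })

  -- X (m+1) = X (m+1)[z_(m+1) = 0] + q^(m+1+|E|) X (m+1), and the first part is X m.
  rec-X : ∀ m → series (X? (suc m)) ≈ series (X? m) ⊕ qPow* (suc m + nE) (series (X? (suc m)))
  rec-X m = begin
    series (X? (suc m))                                                  ≈⟨ peel-first (X? (suc m)) (X-stable (suc m)) X-top ⟩
    series (X? (suc m) ∩? ZeroAt? first) ⊕ qPow* (suc m + nE) (series (X? (suc m)))
      ≈⟨ ⊕-congˡ (qPow* (suc m + nE) (series (X? (suc m)))) top-zero ⟩
    series (X? m) ⊕ qPow* (suc m + nE) (series (X? (suc m)))             ∎
    where
    open ≈-Reasoning
    X-top : ∀ σ → X (suc m) σ → 1 ≤ lookup σ first → All (1 ≤_) σ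
    X-top (t ∷ σ) (xσ , t≤) 1≤t = 1≤t ∷ All.map (ℕP.≤-trans 1≤t) (X-bounded m σ xσ t≤)
    top-zero = count-zeroAt (X? (suc m)) (X? m) first (λ τ xτ → proj₁ xτ) (λ τ xτ → xτ , belowNext-zero m τ)

  -- W (j+1) = W (j+1)[top of the chain = 0] + q^(j+1) W (j+1): the first part
  -- is W j, and otherwise the whole chain drops by 1.
  rec-W : ∀ j → series (W? (suc j)) ≈ series (W? j) ⊕ qPow* (suc j) (series (W? (suc j)))
  rec-W j = begin
    series (W? (suc j))                                                   ≈⟨ series-split (W? (suc j)) (ZeroAt? second) ⟩
    series (W? (suc j) ∩? ZeroAt? second) ⊕ series (W? (suc j) ∩? ∁? (ZeroAt? second))
      ≈⟨ ⊕-congˡ (series (W? (suc j) ∩? ∁? (ZeroAt? second))) chain-top-zero ⟩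
    series (W? j) ⊕ series (W? (suc j) ∩? ∁? (ZeroAt? second))
      ≈⟨ ⊕-congʳ (series (W? j)) (count-shift (W? (suc j)) (∁? (ZeroAt? second)) (suc j) lower raise sum-raise up down) ⟩
    series (W? j) ⊕ qPow* (suc j) (series (W? (suc j)))                   ∎
    where
    open ≈-Reasoning
    chain-top-zero = count-zeroAt (W? (suc j)) (W? j) second
      (λ { (v ∷ τ) (asc , pπ , v≤β) → Linked.tail asc , pπ , v≤β })
      (λ { (v ∷ τ) (asc , pπ , v≤β) → ascending-cons-zero asc , pπ , v≤β })
    lower raise : Vec ℕ (suc (suc j + p)) → Vec ℕ (suc (suc j + p))
    lower (v ∷ r) = v ∷ onFront (suc j) pred r
    raise (v ∷ r) = v ∷ onFront (suc j) suc r
    sum-raise : ∀ τ → sum (raise τ) ≡ suc j + sum τ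
    sum-raise (v ∷ r) = trans (cong (v +_) (sum-onFront (suc j) r)) (+-swap v (suc j) (sum r))
    W-onFront : ∀ {f} → f Preserves _≤_ ⟶ _≤_ → ∀ v r → W (suc j) (v ∷ r) → W (suc j) (v ∷ onFront (suc j) f r)
    W-onFront {f} mono v r (asc , pπ , v≤β)
      rewrite take-++ (map f (take (suc j) r)) (drop (suc j) r) | drop-++ (map f (take (suc j) r)) (drop (suc j) r) =
      ascending-map mono asc , pπ , v≤β
    up : ∀ τ → W (suc j) τ → (W (suc j) (raise τ) × ∁ (ZeroAt second) (raise τ)) × lower (raise τ) ≡ τ
    up (v ∷ x ∷ r) wτ = (W-onFront s≤s v (x ∷ r) wτ , λ ()) , cong (v ∷_) (onFront-lower-raise (suc j) (x ∷ r))
    down : ∀ σ → W (suc j) σ → ∁ (ZeroAt second) σ → W (suc j) (lower σ) × raise (lower σ) ≡ σ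
    down (v ∷ x ∷ r) wσ@(asc , _ , _) x≢0 =
      W-onFront ℕP.pred-mono-≤ v (x ∷ r) wσ ,
      cong (v ∷_) (onFront-raise-lower (suc j) (x ∷ r) (ascending-bounded asc (nonzero⇒positive x≢0)))

  -- U = W k′[top ≠ 0] is q^(p+1) W k′: lower the top of P⁺ and all of P.
  U-shift : series U? ≈ qPow* (suc p) (series (W? k′))
  U-shift = count-shift (W? k′) (∁? (ZeroAt? first)) (suc p) lower raise sum-raise up down
    where
    lower raise : Vec ℕ (suc (k′ + p)) → Vec ℕ (suc (k′ + p))
    lower (v ∷ r) = pred v ∷ onBack k′ pred r
    raise (v ∷ r) = suc v ∷ onBack k′ suc r
    sum-raise : ∀ τ → sum (raise τ) ≡ suc p + sum τ
    sum-raise (v ∷ r) = cong suc (trans (cong (v +_) (sum-onBack k′ r)) (+-swap v p (sum r)))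
    W-onBack : ∀ {f} → f Preserves _≤_ ⟶ _≤_ → ∀ v r → W k′ (v ∷ r) → W k′ (f v ∷ onBack k′ f r)
    W-onBack {f} mono v r (asc , pπ , v≤β)
      rewrite take-++ (take k′ r) (map f (drop k′ r)) | drop-++ (take k′ r) (map f (drop k′ r)) =
      asc , partition-map mono (drop k′ r) pπ , subst (f v ≤_) (sym (β-map f (drop k′ r))) (mono v≤β)
    up : ∀ τ → W k′ τ → (W k′ (raise τ) × ∁ (ZeroAt first) (raise τ)) × lower (raise τ) ≡ τ
    up (v ∷ r) wτ = (W-onBack s≤s v r wτ , λ ()) , cong (v ∷_) (onBack-lower-raise k′ r)
    down : ∀ σ → W k′ σ → ∁ (ZeroAt first) σ → W k′ (lower σ) × raise (lower σ) ≡ σ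
    down (zero  ∷ r) _ v≢0 = ⊥-elim (v≢0 refl)
    down (suc v ∷ r) wσ@(_ , pπ , v≤β) _ =
      W-onBack ℕP.pred-mono-≤ (suc v) r wσ ,
      cong (suc v ∷_) (onBack-raise-lower k′ r (partition-bounded (drop k′ r) pπ (ℕP.≤-trans (s≤s z≤n) v≤β)))

module Encoding where
  open import Defs
  open Vectors
  open Counting using (Transfers)
  open import Data.Nat using (ℕ; zero; suc; _+_; _≤_; _≥_; z≤n)
  import Data.Nat.Properties as ℕP
  open import Algebra.Properties.CommutativeSemigroup ℕP.+-commutativeSemigroup
    using () renaming (x∙yz≈y∙xz to +-swap)
  open import Data.Nat.Tactic.RingSolver using (solve-∀)
  open import Data.Fin as Fin using (Fin; toℕ; splitAt; _↑ˡ_; _↑ʳ_)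
  import Data.Fin.Properties as FinP
  open import Data.Vec as Vec using (Vec; []; _∷_; _++_; lookup; reverse; sum; take; drop; replicate)
  open import Data.Vec.Properties using (lookup-splitAt; lookup-++ˡ; lookup-++ʳ; reverse-involutive; sum-++)
  open import Data.Vec.Relation.Unary.Linked using ([]; [-]; _∷_)
  open import Data.Sum using (inj₁; inj₂)
  open import Data.Unit using (tt)
  open import Data.Product using (_×_; _,_)
  open import Function.Bundles using (_⇔_; mk⇔; Equivalence)
  open import Relation.Nullary using (Dec)
  open import Relation.Binary using (Rel)
  open import Relation.Binary.Construct.Closure.ReflexiveTransitive using (Star; ε; _◅_)
  open import Relation.Binary.PropositionalEquality
  open Equivalence using (to; from)
  open import Function.Construct.Identity using (⇔-id)
  open import Function.Construct.Composition using (_⇔-∘_)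

  star-antitone : ∀ {A : Set} {G : Rel A 0ℓ} (val : A → ℕ) →
    (∀ {e e′} → G e e′ → val e′ ≤ val e) → ∀ {e e′} → Star G e e′ → val e′ ≤ val e
  star-antitone val step ε        = ℕP.≤-refl
  star-antitone val step (g ◅ gs) = ℕP.≤-trans (star-antitone val step gs) (step g)

  module Pullback {n} {A : Set} (G : Rel A 0ℓ) (decode : Fin n → A) where

    Order : Rel (Fin n) 0ℓ
    Order i j = Star G (decode i) (decode j)

    partition-from-valuation : ∀ (σ : Vec ℕ n) (val : A → ℕ) → (∀ i → lookup σ i ≡ val (decode i)) →
      (∀ {e e′} → G e e′ → val e′ ≤ val e) → IsPartition Order σ
    partition-from-valuation σ val reads decreasing i j i≤j =
      subst₂ _≤_ (sym (reads j)) (sym (reads i)) (star-antitone val decreasing i≤j)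

    partition-step : ∀ {σ : Vec ℕ n} → IsPartition Order σ → ∀ {i j e e′} →
      decode i ≡ e → decode j ≡ e′ → G e e′ → lookup σ j ≤ lookup σ i
    partition-step pσ {i} {j} refl refl g = pσ i j (g ◅ ε)

  module Frozen {p : ℕ} (_≤P_ : Rel (Fin p) 0ℓ) (_≤P?_ : ∀ a b → Dec (a ≤P b))
                (y1 y2 : Fin p) (below-y1 : ∀ a → a ≤P y1) (k′ m : ℕ) where

    open Models _≤P_ _≤P?_ y1 y2 below-y1 k′

    k C : ℕ
    k = suc k′
    C = suc k + m

    Gen′ = Gen _≤P_ y1 y2 m k

    Decreasing : (DElem p C → ℕ) → Set
    Decreasing val = ∀ {e e′} → Gen′ e e′ → val e′ ≤ val e

    valD : Vec ℕ p → ℕ → Vec ℕ C → DElem p C → ℕ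
    valD π v c (y a) = lookup π a
    valD π v c y0    = v
    valD π v c (z t) = lookup c t

    DCond : Vec ℕ p → ℕ → Vec ℕ C → Set
    DCond π v c = Partition π × Antitone c × AtIndex c (suc k) (_≤ v) ×
                  AtIndex c k (_≤ β π) × AtIndex c k′ (_≤ γ π) × v ≤ β π

    decreasing⇔DCond : ∀ π v c → Decreasing (valD π v c) ⇔ DCond π v c
    decreasing⇔DCond π v c = mk⇔ forth back
      where
      forth : Decreasing (valD π v c) → DCond π v c
      forth dec = (λ a b a≤b → dec (inP a≤b)) , (λ s t s≤t → dec (chain s≤t)) ,
        to (atIndex⇔lookup c (suc k) (_≤ v)) (λ t eq → dec (y0z1 (trans eq (ℕP.+-comm 1 k)))) ,
        to (atIndex⇔lookup c k (_≤ β π)) (λ t eq → dec (y1z0 eq)) ,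
        to (atIndex⇔lookup c k′ (_≤ γ π)) (λ t eq → dec (y2zm1 (trans (ℕP.+-comm (toℕ t) 1) (cong suc eq))))
        , dec y1y0
      back : DCond π v c → Decreasing (valD π v c)
      back (pπ , _ , _ , _ , _ , _) (inP a≤b) = pπ _ _ a≤b
      back (_ , anti , _ , _ , _ , _) (chain s≤t) = anti _ _ s≤t
      back (_ , _ , at-z₁ , _ , _ , _) (y0z1 eq) = from (atIndex⇔lookup c (suc k) (_≤ v)) at-z₁ _ (trans eq (ℕP.+-comm k 1))
      back (_ , _ , _ , at-z₀ , _ , _) (y1z0 eq) = from (atIndex⇔lookup c k (_≤ β π)) at-z₀ _ eq
      back (_ , _ , _ , _ , at-z₋₁ , _) (y2zm1 {t} eq) =
        from (atIndex⇔lookup c k′ (_≤ γ π)) at-z₋₁ t (ℕP.suc-injective (trans (ℕP.+-comm 1 (toℕ t)) eq))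
      back (_ , _ , _ , _ , _ , v≤β) y1y0 = v≤β

    decode = decodeD _≤P_ y1 y2 m k
    open Pullback Gen′ decode

    encode : DElem p C → Fin (p + suc C)
    encode (y a) = a ↑ˡ suc C
    encode y0    = p ↑ʳ Fin.zero
    encode (z t) = p ↑ʳ Fin.suc t

    decode-encode : ∀ e → decode (encode e) ≡ e
    decode-encode (y a) rewrite FinP.splitAt-↑ˡ p a (suc C) = refl
    decode-encode y0    rewrite FinP.splitAt-↑ʳ p (suc C) Fin.zero = refl
    decode-encode (z t) rewrite FinP.splitAt-↑ʳ p (suc C) (Fin.suc t) = refl

    reads-D : ∀ π v c i → lookup (π ++ (v ∷ c)) i ≡ valD π v c (decode i)
    reads-D π v c i rewrite lookup-splitAt p π (v ∷ c) i with splitAt p i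
    ... | inj₁ a            = refl
    ... | inj₂ Fin.zero     = refl
    ... | inj₂ (Fin.suc t)  = refl

    D-partition⇔DCond : ∀ π v c → IsPartition (DOrder _≤P_ y1 y2 m k) (π ++ (v ∷ c)) ⇔ DCond π v c
    D-partition⇔DCond π v c = mk⇔
      (λ pσ → to (decreasing⇔DCond π v c) λ {e} {e′} g →
         subst₂ _≤_ (reads e′) (reads e) (partition-step {π ++ (v ∷ c)} pσ (decode-encode e) (decode-encode e′) g))
      (λ cond → partition-from-valuation (π ++ (v ∷ c)) (valD π v c) (reads-D π v c) (from (decreasing⇔DCond π v c) cond))
      where
      reads : ∀ e → lookup (π ++ (v ∷ c)) (encode e) ≡ valD π v c e
      reads e = trans (reads-D π v c (encode e)) (cong (valD π v c) (decode-encode e))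

    Dk-pieces : ∀ (w : Vec ℕ (suc k)) π →
      Dk (w ++ π) ⇔ (Ascending w × Partition π × AtIndex w 1 (_≤ γ π) × AtIndex w 0 (_≤ β π))
    Dk-pieces (z₀ ∷ z₋₁ ∷ w′) π rewrite take-++ w′ π | drop-++ w′ π = mk⇔
      (λ ((asc , pπ , z₋₁≤γ) , z₀≤z₋₁ , z₀≤β) → (z₀≤z₋₁ ∷ asc) , pπ , z₋₁≤γ , z₀≤β)
      (λ { ((z₀≤z₋₁ ∷ asc) , pπ , z₋₁≤γ , z₀≤β) → (asc , pπ , z₋₁≤γ) , z₀≤z₋₁ , z₀≤β })

    E-pieces : ∀ v (w : Vec ℕ (suc k)) π → E (v ∷ (w ++ π)) ⇔ (Dk (w ++ π) × v ≤ β π)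
    E-pieces v (z₀ ∷ z₋₁ ∷ w′) π rewrite drop-++ w′ π = ⇔-id _

    X-split : ∀ m (ts : Vec ℕ m) v z₀ (σ : Vec ℕ nR) →
      X m (ts ++ (v ∷ z₀ ∷ σ)) ⇔ (E (v ∷ z₀ ∷ σ) × Ascending ts × OnLast (_≤ v) ts × OnLast (_≤ z₀) ts)
    X-split m ts v z₀ σ = mk⇔ (forth m ts) (back m ts)
      where
      forth : ∀ m (ts : Vec ℕ m) → X m (ts ++ (v ∷ z₀ ∷ σ)) → E (v ∷ z₀ ∷ σ) × Ascending ts × OnLast (_≤ v) ts × OnLast (_≤ z₀) ts
      forth zero          []            eσ                = eσ , [] , tt , tt
      forth (suc zero)    (t ∷ [])      (eσ , t≤v , t≤z₀) = eσ , [-] , t≤v , t≤z₀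
      forth (suc (suc m)) (t ∷ t′ ∷ ts) (xσ , t≤t′)      =
        let (eσ , asc , l₁ , l₂) = forth (suc m) (t′ ∷ ts) xσ in eσ , t≤t′ ∷ asc , l₁ , l₂
      back : ∀ m (ts : Vec ℕ m) → E (v ∷ z₀ ∷ σ) × Ascending ts × OnLast (_≤ v) ts × OnLast (_≤ z₀) ts → X m (ts ++ (v ∷ z₀ ∷ σ))
      back zero          []            (eσ , _ , _ , _)             = eσ
      back (suc zero)    (t ∷ [])      (eσ , _ , t≤v , t≤z₀)        = eσ , t≤v , t≤z₀
      back (suc (suc m)) (t ∷ t′ ∷ ts) (eσ , t≤t′ ∷ asc , l₁ , l₂) = back (suc m) (t′ ∷ ts) (eσ , asc , l₁ , l₂) , t≤t′

    -- Reversing the two parts of the chain turns the conditions into the model X m.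
    DCond⇔X : ∀ π v (w : Vec ℕ (suc k)) (ts : Vec ℕ m) → DCond π v (reverse w ++ reverse ts) ⇔ X m (ts ++ (v ∷ (w ++ π)))
    DCond⇔X π v w@(z₀ ∷ z₋₁ ∷ w′) ts = mk⇔ forth back
      where
      c = reverse w ++ reverse ts
      c-cond : Antitone c ⇔ (Ascending w × Ascending ts × OnLast (_≤ z₀) ts)
      c-cond = mk⇔
        (λ anti → let (dw , dts , bridge) = to (linked-++ (reverse w) (reverse ts)) (to (antitone⇔descending c) anti) in
          to (descending-reverse⇔ascending w) dw , to (descending-reverse⇔ascending ts) dts ,
          to (atIndex0-reverse ts (_≤ z₀)) (to (onLast-reverse w _) bridge))
        (λ (aw , ats , last) → from (antitone⇔descending c) (from (linked-++ (reverse w) (reverse ts))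
          (from (descending-reverse⇔ascending w) aw , from (descending-reverse⇔ascending ts) ats ,
           from (onLast-reverse w _) (from (atIndex0-reverse ts (_≤ z₀)) last))))
      at-z₁ : AtIndex c (suc k) (_≤ v) ⇔ OnLast (_≤ v) ts
      at-z₁ = atIndex0-reverse ts (_≤ v) ⇔-∘ atIndex-++-boundary (reverse w) (reverse ts) (_≤ v)
      at-z₀ : AtIndex c k (_≤ β π) ⇔ z₀ ≤ β π
      at-z₀ = atIndex-reverse-first z₀ (z₋₁ ∷ w′) (_≤ β π) ⇔-∘ atIndex-++ˡ (reverse w) (reverse ts) (_≤ β π) ℕP.≤-refl
      at-z₋₁ : AtIndex c k′ (_≤ γ π) ⇔ z₋₁ ≤ γ π
      at-z₋₁ = atIndex-reverse-second z₀ z₋₁ w′ (_≤ γ π) ⇔-∘ atIndex-++ˡ (reverse w) (reverse ts) (_≤ γ π) (ℕP.n≤1+n _)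
      forth : DCond π v c → X m (ts ++ (v ∷ (w ++ π)))
      forth (pπ , anti , z₁≤v , z₀≤β , z₋₁≤γ , v≤β) =
        let (aw , ats , z₁≤z₀) = to c-cond anti in
        from (X-split m ts v z₀ (z₋₁ ∷ (w′ ++ π)))
          (from (E-pieces v w π) (from (Dk-pieces w π) (aw , pπ , to at-z₋₁ z₋₁≤γ , to at-z₀ z₀≤β) , v≤β) ,
           ats , to at-z₁ z₁≤v , z₁≤z₀)
      back : X m (ts ++ (v ∷ (w ++ π))) → DCond π v c
      back xσ =
        let (eσ , ats , z₁≤v , z₁≤z₀) = to (X-split m ts v z₀ (z₋₁ ∷ (w′ ++ π))) xσ
            (dσ , v≤β) = to (E-pieces v w π) eσ
            (aw , pπ , z₋₁≤γ , z₀≤β) = to (Dk-pieces w π) dσ in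
        pπ , from c-cond (aw , ats , z₁≤z₀) , from at-z₁ z₁≤v , from at-z₀ z₀≤β , from at-z₋₁ z₋₁≤γ , v≤β

    -- The bijection between the frozen layout of D_{m,k}(P) and the model X m:
    --   π ++ v ∷ (c₁ ++ c₂)   ↦   reverse c₂ ++ v ∷ (reverse c₁ ++ π).
    shapeD : Vec ℕ (p + suc C) → Vec ℕ (m + nE)
    shapeD σ = let c = Vec.tail (drop p σ) in
      reverse (drop (suc k) c) ++ (Vec.head (drop p σ) ∷ (reverse (take (suc k) c) ++ take p σ))

    unshapeD : Vec ℕ (m + nE) → Vec ℕ (p + suc C)
    unshapeD τ = let r = Vec.tail (drop m τ) in
      drop (suc k) r ++ (Vec.head (drop m τ) ∷ (reverse (take (suc k) r) ++ reverse (take m τ)))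

    shapeD-pieces : ∀ (π : Vec ℕ p) v (c₁ : Vec ℕ (suc k)) (c₂ : Vec ℕ m) →
      shapeD (π ++ (v ∷ (c₁ ++ c₂))) ≡ reverse c₂ ++ (v ∷ (reverse c₁ ++ π))
    shapeD-pieces π v c₁ c₂
      rewrite take-++ π (v ∷ (c₁ ++ c₂)) | drop-++ π (v ∷ (c₁ ++ c₂)) | take-++ c₁ c₂ | drop-++ c₁ c₂ = refl

    unshapeD-pieces : ∀ (ts : Vec ℕ m) v (w : Vec ℕ (suc k)) (π : Vec ℕ p) →
      unshapeD (ts ++ (v ∷ (w ++ π))) ≡ π ++ (v ∷ (reverse w ++ reverse ts))
    unshapeD-pieces ts v w π rewrite take-++ ts (v ∷ (w ++ π)) | drop-++ ts (v ∷ (w ++ π)) | take-++ w π | drop-++ w π = refl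

    sum-pieces : ∀ {a b c} (xs : Vec ℕ a) v (ys : Vec ℕ b) (zs : Vec ℕ c) →
      sum (xs ++ (v ∷ (ys ++ zs))) ≡ v + (sum xs + (sum ys + sum zs))
    sum-pieces xs v ys zs = begin
      sum (xs ++ (v ∷ (ys ++ zs)))        ≡⟨ sum-++ xs ⟩
      sum xs + (v + sum (ys ++ zs))       ≡⟨ cong (λ x → sum xs + (v + x)) (sum-++ ys) ⟩
      sum xs + (v + (sum ys + sum zs))    ≡⟨ +-swap (sum xs) v _ ⟩
      v + (sum xs + (sum ys + sum zs))    ∎
      where
      open ≡-Reasoning

    sum-shapeD : ∀ (π : Vec ℕ p) v (c₁ : Vec ℕ (suc k)) (c₂ : Vec ℕ m) →
      sum (reverse c₂ ++ (v ∷ (reverse c₁ ++ π))) ≡ sum (π ++ (v ∷ (c₁ ++ c₂)))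
    sum-shapeD π v c₁ c₂ = begin
      sum (reverse c₂ ++ (v ∷ (reverse c₁ ++ π)))          ≡⟨ sum-pieces (reverse c₂) v (reverse c₁) π ⟩
      v + (sum (reverse c₂) + (sum (reverse c₁) + sum π)) ≡⟨ cong₂ (λ x y → v + (x + (y + sum π))) (sum-reverse c₂) (sum-reverse c₁) ⟩
      v + (sum c₂ + (sum c₁ + sum π))                     ≡⟨ rearrange v (sum c₂) (sum c₁) (sum π) ⟩
      v + (sum π + (sum c₁ + sum c₂))                     ≡⟨ sum-pieces π v c₁ c₂ ⟨
      sum (π ++ (v ∷ (c₁ ++ c₂)))                         ∎
      where
      open ≡-Reasoning
      rearrange : ∀ a b c d → a + (b + (c + d)) ≡ a + (d + (c + b))
      rearrange = solve-∀

    sum-unshapeD : ∀ (ts : Vec ℕ m) v (w : Vec ℕ (suc k)) (π : Vec ℕ p) →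
      sum (π ++ (v ∷ (reverse w ++ reverse ts))) ≡ sum (ts ++ (v ∷ (w ++ π)))
    sum-unshapeD ts v w π = begin
      sum (π ++ (v ∷ (reverse w ++ reverse ts)))          ≡⟨ sum-pieces π v (reverse w) (reverse ts) ⟩
      v + (sum π + (sum (reverse w) + sum (reverse ts))) ≡⟨ cong₂ (λ x y → v + (sum π + (x + y))) (sum-reverse w) (sum-reverse ts) ⟩
      v + (sum π + (sum w + sum ts))                     ≡⟨ rearrange v (sum π) (sum w) (sum ts) ⟩
      v + (sum ts + (sum w + sum π))                     ≡⟨ sum-pieces ts v w π ⟨
      sum (ts ++ (v ∷ (w ++ π)))                         ∎
      where
      open ≡-Reasoning
      rearrange : ∀ a b c d → a + (b + (c + d)) ≡ a + (d + (c + b))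
      rearrange = solve-∀

    D→X : ∀ N → Transfers (IsPartition (DOrder _≤P_ y1 y2 m k)) N (X m) N shapeD unshapeD
    D→X N σ pσ sσ with Vec.splitAt p σ
    ... | π , v ∷ c , refl with Vec.splitAt (suc k) c
    ... | c₁ , c₂ , refl rewrite unshapeD-pieces (reverse c₂) v (reverse c₁) π
                               | reverse-involutive c₁ | reverse-involutive c₂ =
      to (DCond⇔X π v (reverse c₁) (reverse c₂)) (subst (DCond π v) c≡ (to (D-partition⇔DCond π v (c₁ ++ c₂)) pσ)) ,
      trans (sum-shapeD π v c₁ c₂) sσ , refl
      where
      c≡ : c₁ ++ c₂ ≡ reverse (reverse c₁) ++ reverse (reverse c₂)
      c≡ = sym (cong₂ _++_ (reverse-involutive c₁) (reverse-involutive c₂))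

    X→D : ∀ N → Transfers (X m) N (IsPartition (DOrder _≤P_ y1 y2 m k)) N unshapeD shapeD
    X→D N τ xτ sτ with Vec.splitAt m τ
    ... | ts , v ∷ r , refl with Vec.splitAt (suc k) r
    ... | w , π , refl rewrite shapeD-pieces π v (reverse w) (reverse ts)
                             | reverse-involutive w | reverse-involutive ts =
      from (D-partition⇔DCond π v (reverse w ++ reverse ts)) (from (DCond⇔X π v w ts) xτ) ,
      trans (sum-unshapeD ts v w π) sτ , refl

    decodeK = decodeDk _≤P_ y1 y2 m k
    module PK = Pullback Gen′ decodeK

    DkCond : Vec ℕ p → Vec ℕ (suc k) → Set
    DkCond π c₁ = Partition π × Antitone c₁ × AtIndex c₁ k (_≤ β π) × AtIndex c₁ k′ (_≤ γ π)

    decodeK-y : ∀ a → decodeK (a ↑ˡ suc k) ≡ y a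
    decodeK-y a rewrite FinP.splitAt-↑ˡ p a (suc k) = refl

    decodeK-z : ∀ t → decodeK (p ↑ʳ t) ≡ z (t ↑ˡ m)
    decodeK-z t rewrite FinP.splitAt-↑ʳ p (suc k) t = refl

    zeros : Vec ℕ m
    zeros = replicate m 0

    -- Extending by y0 and z₁, …, z_m all valued 0 gives a valuation of D_{m,k}(P).
    reads-K : ∀ π (c₁ : Vec ℕ (suc k)) i → lookup (π ++ c₁) i ≡ valD π 0 (c₁ ++ zeros) (decodeK i)
    reads-K π c₁ i rewrite lookup-splitAt p π c₁ i with splitAt p i
    ... | inj₁ a = refl
    ... | inj₂ t = sym (lookup-++ˡ c₁ zeros t)

    DkCond⇒DCond : ∀ π c₁ → DkCond π c₁ → DCond π 0 (c₁ ++ zeros)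
    DkCond⇒DCond π c₁ (pπ , anti , at-z₀ , at-z₋₁) =
      pπ ,
      from (antitone⇔descending (c₁ ++ zeros))
        (from (linked-++ c₁ zeros) (to (antitone⇔descending c₁) anti , zeros-descending m ,
                                    onLast-all {c = c₁} (λ x → zeros-first m {x ≥_} z≤n))) ,
      from (atIndex-++-boundary c₁ zeros (_≤ 0)) (zeros-first m ℕP.≤-refl) ,
      from (atIndex-++ˡ c₁ zeros (_≤ β π) ℕP.≤-refl) at-z₀ ,
      from (atIndex-++ˡ c₁ zeros (_≤ γ π) (ℕP.n≤1+n _)) at-z₋₁ ,
      z≤n
      where
      zeros-descending : ∀ n → Descending (replicate n 0)
      zeros-descending zero          = []
      zeros-descending (suc zero)    = [-]
      zeros-descending (suc (suc n)) = z≤n ∷ zeros-descending (suc n)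
      zeros-first : ∀ n {P : ℕ → Set} → P 0 → AtIndex (replicate n 0) 0 P
      zeros-first zero    _  = tt
      zeros-first (suc n) p0 = p0
      onLast-all : ∀ {n} {P : ℕ → Set} {c : Vec ℕ n} → (∀ x → P x) → OnLast P c
      onLast-all {c = []}          all = tt
      onLast-all {c = a ∷ []}      all = all a
      onLast-all {c = a ∷ b ∷ c}   all = onLast-all {c = b ∷ c} all

    Dk-partition⇔DkCond : ∀ π c₁ → IsPartition (DkOrder _≤P_ y1 y2 m k) (π ++ c₁) ⇔ DkCond π c₁
    Dk-partition⇔DkCond π c₁ = mk⇔ forth back
      where
      σ = π ++ c₁
      forth : IsPartition (DkOrder _≤P_ y1 y2 m k) σ → DkCond π c₁
      forth pσ =
        (λ a b a≤b → subst₂ _≤_ (lookup-++ˡ π c₁ b) (lookup-++ˡ π c₁ a) (step (decodeK-y a) (decodeK-y b) (inP a≤b))) ,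
        (λ s t s≤t → subst₂ _≤_ (lookup-++ʳ π c₁ t) (lookup-++ʳ π c₁ s)
           (step (decodeK-z s) (decodeK-z t) (chain (subst₂ _≤_ (sym (FinP.toℕ-↑ˡ s m)) (sym (FinP.toℕ-↑ˡ t m)) s≤t)))) ,
        to (atIndex⇔lookup c₁ k (_≤ β π)) (λ t eq → subst₂ _≤_ (lookup-++ʳ π c₁ t) (lookup-++ˡ π c₁ y1)
           (step (decodeK-y y1) (decodeK-z t) (y1z0 (trans (FinP.toℕ-↑ˡ t m) eq)))) ,
        to (atIndex⇔lookup c₁ k′ (_≤ γ π)) (λ t eq → subst₂ _≤_ (lookup-++ʳ π c₁ t) (lookup-++ˡ π c₁ y2)
           (step (decodeK-y y2) (decodeK-z t)
                 (y2zm1 (trans (cong (_+ 1) (FinP.toℕ-↑ˡ t m)) (trans (ℕP.+-comm (toℕ t) 1) (cong suc eq))))))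
        where
        step : ∀ {i j e e′} → decodeK i ≡ e → decodeK j ≡ e′ → Gen′ e e′ → lookup σ j ≤ lookup σ i
        step = PK.partition-step {σ} pσ
      back : DkCond π c₁ → IsPartition (DkOrder _≤P_ y1 y2 m k) σ
      back cond = PK.partition-from-valuation σ (valD π 0 (c₁ ++ zeros)) (reads-K π c₁)
                    (from (decreasing⇔DCond π 0 (c₁ ++ zeros)) (DkCond⇒DCond π c₁ cond))

    DkCond⇔Dk : ∀ (π : Vec ℕ p) (w : Vec ℕ (suc k)) → DkCond π (reverse w) ⇔ Dk (w ++ π)
    DkCond⇔Dk π w@(z₀ ∷ z₋₁ ∷ w′) = mk⇔
      (λ (pπ , anti , at-z₀ , at-z₋₁) → from (Dk-pieces w π)
         (to (descending-reverse⇔ascending w) (to (antitone⇔descending (reverse w)) anti) , pπ ,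
          to (atIndex-reverse-second z₀ z₋₁ w′ (_≤ γ π)) at-z₋₁ , to (atIndex-reverse-first z₀ (z₋₁ ∷ w′) (_≤ β π)) at-z₀))
      (λ dσ → let (aw , pπ , z₋₁≤γ , z₀≤β) = to (Dk-pieces w π) dσ in
         pπ , from (antitone⇔descending (reverse w)) (from (descending-reverse⇔ascending w) aw) ,
         from (atIndex-reverse-first z₀ (z₋₁ ∷ w′) (_≤ β π)) z₀≤β , from (atIndex-reverse-second z₀ z₋₁ w′ (_≤ γ π)) z₋₁≤γ)

    shapeDk : Vec ℕ (p + suc k) → Vec ℕ (suc nR)
    shapeDk σ = reverse (drop p σ) ++ take p σ

    unshapeDk : Vec ℕ (suc nR) → Vec ℕ (p + suc k)
    unshapeDk τ = drop (suc k) τ ++ reverse (take (suc k) τ)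

    sum-shapeDk : ∀ (π : Vec ℕ p) (c₁ : Vec ℕ (suc k)) → sum (reverse c₁ ++ π) ≡ sum (π ++ c₁)
    sum-shapeDk π c₁ = begin
      sum (reverse c₁ ++ π)      ≡⟨ sum-++ (reverse c₁) ⟩
      sum (reverse c₁) + sum π   ≡⟨ cong (_+ sum π) (sum-reverse c₁) ⟩
      sum c₁ + sum π             ≡⟨ ℕP.+-comm (sum c₁) (sum π) ⟩
      sum π + sum c₁             ≡⟨ sum-++ π ⟨
      sum (π ++ c₁)              ∎
      where open ≡-Reasoning

    Dk→model : ∀ N → Transfers (IsPartition (DkOrder _≤P_ y1 y2 m k)) N Dk N shapeDk unshapeDk
    Dk→model N σ pσ sσ with Vec.splitAt p σ
    ... | π , c₁ , refl rewrite take-++ (reverse c₁) π | drop-++ (reverse c₁) π | reverse-involutive c₁ =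
      to (DkCond⇔Dk π (reverse c₁)) (subst (DkCond π) (sym (reverse-involutive c₁)) (to (Dk-partition⇔DkCond π c₁) pσ)) ,
      trans (sum-shapeDk π c₁) sσ , refl

    model→Dk : ∀ N → Transfers Dk N (IsPartition (DkOrder _≤P_ y1 y2 m k)) N unshapeDk shapeDk
    model→Dk N τ dτ sτ with Vec.splitAt (suc k) τ
    ... | w , π , refl rewrite take-++ π (reverse w) | drop-++ π (reverse w) | reverse-involutive w =
      from (Dk-partition⇔DkCond π (reverse w)) (from (DkCond⇔Dk π w) dτ) ,
      trans (sym (subst (λ w′ → sum (w′ ++ π) ≡ sum (π ++ reverse w)) (reverse-involutive w)
                        (sum-shapeDk π (reverse w)))) sτ ,
      refl

    valP : Vec ℕ p → ℕ → PlusElem p → ℕ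
    valP π t (old a) = lookup π a
    valP π t top     = t

    reads-P : ∀ π t i → lookup (π ++ (t ∷ [])) i ≡ valP π t (decodePlus i)
    reads-P π t i rewrite lookup-splitAt p π (t ∷ []) i with splitAt p i
    ... | inj₁ a        = refl
    ... | inj₂ Fin.zero = refl

    decodeP-old : ∀ a → decodePlus {p} (a ↑ˡ 1) ≡ old a
    decodeP-old a rewrite FinP.splitAt-↑ˡ p a 1 = refl

    decodeP-top : decodePlus {p} (p ↑ʳ Fin.zero) ≡ top
    decodeP-top rewrite FinP.splitAt-↑ʳ p 1 Fin.zero = refl

    Plus-partition⇔W : ∀ π t → IsPartition (PlusOrder _≤P_) (π ++ (t ∷ [])) ⇔ W 0 (t ∷ π)
    Plus-partition⇔W π t = mk⇔ forth back
      where
      σ = π ++ (t ∷ [])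
      forth : IsPartition (PlusOrder _≤P_) σ → W 0 (t ∷ π)
      forth pσ =
        [] ,
        (λ a b a≤b → subst₂ _≤_ (lookup-++ˡ π _ b) (lookup-++ˡ π _ a)
           (pσ (a ↑ˡ 1) (b ↑ˡ 1) (subst₂ (PlusLe _≤P_) (sym (decodeP-old a)) (sym (decodeP-old b)) (old≤old a≤b)))) ,
        subst₂ _≤_ (lookup-++ʳ π (t ∷ []) Fin.zero) (lookup-++ˡ π _ y1)
           (pσ (y1 ↑ˡ 1) (p ↑ʳ Fin.zero) (subst₂ (PlusLe _≤P_) (sym (decodeP-old y1)) (sym decodeP-top) ≤top))
      decreasing : Partition π → t ≤ β π → ∀ {e e′} → PlusLe _≤P_ e e′ → valP π t e′ ≤ valP π t e
      decreasing pπ t≤β (old≤old a≤b) = pπ _ _ a≤b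
      decreasing pπ t≤β {old a} ≤top = ℕP.≤-trans t≤β (pπ a y1 (below-y1 a))
      decreasing pπ t≤β {top}   ≤top = ℕP.≤-refl
      back : W 0 (t ∷ π) → IsPartition (PlusOrder _≤P_) σ
      back (_ , pπ , t≤β) i j i≤j = subst₂ _≤_ (sym (reads-P π t j)) (sym (reads-P π t i)) (decreasing pπ t≤β i≤j)

    shapeP : Vec ℕ (p + 1) → Vec ℕ (suc (0 + p))
    shapeP σ = Vec.head (drop p σ) ∷ take p σ

    unshapeP : Vec ℕ (suc (0 + p)) → Vec ℕ (p + 1)
    unshapeP (t ∷ π) = π ++ (t ∷ [])

    sum-shapeP : ∀ (π : Vec ℕ p) t → sum (t ∷ π) ≡ sum (π ++ (t ∷ []))
    sum-shapeP π t = trans (ℕP.+-comm t (sum π)) (sym (trans (sum-++ π) (cong (sum π +_) (ℕP.+-identityʳ t))))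

    Plus→W : ∀ N → Transfers (IsPartition (PlusOrder _≤P_)) N (W 0) N shapeP unshapeP
    Plus→W N σ pσ sσ with Vec.splitAt p σ
    ... | π , t ∷ [] , refl = to (Plus-partition⇔W π t) pσ , trans (sum-shapeP π t) sσ , refl

    W→Plus : ∀ N → Transfers (W 0) N (IsPartition (PlusOrder _≤P_)) N unshapeP shapeP
    W→Plus N (t ∷ π) wσ sσ rewrite take-++ π (t ∷ []) | drop-++ π (t ∷ []) =
      from (Plus-partition⇔W π t) wσ , trans (sym (sum-shapeP π t)) sσ , refl

module Assembly where
  open import Defs
  open Counting
  open Series
  open Recurrences
  open Vectors
  open Encoding
  open import Data.Nat using (ℕ; zero; suc; _+_; _*_; _∸_; _≤_; z≤n; s≤s)
  import Data.Nat.Properties as ℕP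
  open import Data.Nat.Tactic.RingSolver using (solve-∀)
  open import Data.Fin as Fin using (Fin)
  import Data.Fin.Properties as FinP
  open import Data.Fin.Induction using (po-noetherian)
  import Data.Integer as ℤ
  open import Data.Product using (_×_; _,_)
  open import Data.Vec using (Vec)
  open import Relation.Unary using (Pred; Decidable)
  open import Data.Empty using (⊥-elim)
  open import Induction.WellFounded using (Acc; acc)
  open import Relation.Binary using (Rel; IsPartialOrder)
  import Relation.Binary.Construct.NonStrictToStrict as ToStrict
  open import Relation.Nullary using (¬_; Dec; yes; no)
  open import Relation.Nullary.Decidable using (_×-dec_; ¬?; ¬¬-excluded-middle)
  open import Relation.Nullary.Negation using (DoubleNegation)
  open import Relation.Binary.PropositionalEquality

  -- In a finite poset, an element with nothing strictly above it is maximal, and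
  -- strict ascents terminate; so a unique maximal element lies above everything.
  below-unique-maximal : ∀ {p} {_≤P_ : Rel (Fin p) 0ℓ} → IsPartialOrder _≡_ _≤P_ → (∀ a b → Dec (a ≤P b)) →
    ∀ {y1} → UniqueMaximal _≤P_ y1 → ∀ a → a ≤P y1
  below-unique-maximal {_≤P_ = _≤P_} isPO _≤P?_ {y1} (_ , unique) a = climb a (po-noetherian isPO a)
    where
    open IsPartialOrder isPO using (reflexive) renaming (trans to ≤-trans)
    _<P_ = ToStrict._<_ _≡_ _≤P_
    climb : ∀ a → Acc (λ x w → w <P x) a → a ≤P y1
    climb a (acc above) with FinP.any? (λ w → (a ≤P? w) ×-dec ¬? (w FinP.≟ a))
    ... | yes (w , a≤w , w≢a) = ≤-trans a≤w (climb w (above (a≤w , λ a≡w → w≢a (sym a≡w))))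
    ... | no  nothing-above   = reflexive (unique a maximal)
      where
      maximal : Maximal _≤P_ a
      maximal w a≤w with w FinP.≟ a
      ... | yes w≡a = w≡a
      ... | no  w≢a = ⊥-elim (nothing-above (w , a≤w , w≢a))

  ¬¬-all : ∀ n {P : Fin n → Set} → (∀ i → DoubleNegation (P i)) → DoubleNegation (∀ i → P i)
  ¬¬-all zero    _ k = k (λ ())
  ¬¬-all (suc n) f k =
    f Fin.zero (λ p₀ → ¬¬-all n (λ i → f (Fin.suc i)) (λ ps → k (λ { Fin.zero → p₀ ; (Fin.suc i) → ps i })))

  ¬¬-decidable : ∀ {p} (R : Rel (Fin p) 0ℓ) → DoubleNegation (∀ a b → Dec (R a b))
  ¬¬-decidable {p} R = ¬¬-all p (λ a → ¬¬-all p (λ b → ¬¬-excluded-middle))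

  module WithDecidableOrder {p : ℕ} (_≤P_ : Rel (Fin p) 0ℓ) (_≤P?_ : ∀ a b → Dec (a ≤P b))
                  (y1 y2 : Fin p) (below-y1 : ∀ a → a ≤P y1) (k′ m : ℕ) where

    open Models _≤P_ _≤P?_ y1 y2 below-y1 k′
    open Frozen _≤P_ _≤P?_ y1 y2 below-y1 k′ m

    gf≈count : ∀ {n n′} {R : Rel (Fin n) 0ℓ} {f} {Q : Pred (Vec ℕ n′) 0ℓ} (Q? : Decidable Q) {g h} →
      IsGF R f → (∀ N → Transfers (IsPartition R) N Q N g h) → (∀ N → Transfers Q N (IsPartition R) N h g) →
      toPS f ≈ series Q?
    gf≈count Q? gf forth back N with gf N
    ... | L , unique , members , length≡ =
      cong ℤ.+_ (trans (sym length≡) (enumeration-bijection (unique , members) (count-enumerates Q? N) (forth N) (back N)))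

    a : ℕ
    a = suc nR

    X≈ : series (X? m) ≈ divPoch (suc nE) m (series E?)
    X≈ = pochhammer-chain (suc nE) (s≤s z≤n) (λ j → series (X? j)) rec m
      where
      rec : ∀ j → series (X? (suc j)) ≈ series (X? j) ⊕ qPow* (suc nE + j) (series (X? (suc j)))
      rec j N = trans (rec-X j N) (cong (λ w → series (X? j) N ℤ.+ qPow* w (series (X? (suc j))) N) (cong suc (ℕP.+-comm j nE)))

    W≈ : series (W? k′) ≈ divPoch 1 k′ (series (W? 0))
    W≈ = pochhammer-chain 1 (s≤s z≤n) (λ j → series (W? j)) rec-W k′

    E≈ : series E? ≈ divOneMinusQPow (suc a) (divOneMinusQPow a (series U? ⊕ oneMinusQPow* (a + a) (series Dk?)))
    E≈ = four-recurrences a (s≤s z≤n) {series Dk?} {series R?} {series S?} {series S₊?} {series U?} {series E?}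
           rec-Dk split-S rec-S rec-E

    F : PS
    F = qPow* (suc p) (divPoch 1 k′ (series (W? 0))) ⊕ oneMinusQPow* (a + a) (series Dk?)

    D-identity : series (X? m) ≈ divPoch a (suc (suc m)) F
    D-identity = begin
      series (X? m)                                                ≈⟨ X≈ ⟩
      divPoch (suc nE) m (series E?)                               ≈⟨ divPoch-cong (suc nE) m E≈ ⟩
      divPoch (suc nE) m (divOneMinusQPow (suc a) (divOneMinusQPow a (series U? ⊕ oneMinusQPow* (a + a) (series Dk?))))
        ≈⟨ divPoch-cong (suc nE) m (divOneMinusQPow-cong (suc a) (divOneMinusQPow-cong a
             (⊕-congˡ (oneMinusQPow* (a + a) (series Dk?)) U≈))) ⟩
      divPoch a (suc (suc m)) F                                    ∎
      where
      open ≈-Reasoning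
      U≈ : series U? ≈ qPow* (suc p) (divPoch 1 k′ (series (W? 0)))
      U≈ n = trans (U-shift n) (qPow*-cong (suc p) W≈ n)

    module _ (gfD gfPplus gfDk : ℕ → ℕ) (HD : IsGF (DOrder _≤P_ y1 y2 m (suc k′)) gfD)
             (HP : IsGF (PlusOrder _≤P_) gfPplus) (HDk : IsGF (DkOrder _≤P_ y1 y2 m (suc k′)) gfDk) where

      D≈ : toPS gfD ≈ series (X? m)
      D≈ = gf≈count (X? m) HD D→X X→D

      Dk≈ : toPS gfDk ≈ series Dk?
      Dk≈ = gf≈count Dk? HDk Dk→model model→Dk

      P≈ : toPS gfPplus ≈ series (W? 0)
      P≈ = gf≈count (W? 0) HP Plus→W W→Plus

      exponents : ∀ {b b′ r r′ c c′ d d′} → b ≡ b′ → r ≡ r′ → c ≡ c′ → d ≡ d′ →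
        divPoch b r (qPow* c (divPoch 1 k′ (toPS gfPplus)) ⊕ oneMinusQPow* d (toPS gfDk)) ≈
        divPoch b′ r′ (qPow* c′ (divPoch 1 k′ (toPS gfPplus)) ⊕ oneMinusQPow* d′ (toPS gfDk))
      exponents refl refl refl refl N = refl

      identity : toPS gfD ≈ divPoch (p + suc k′ + 1) (m + 2)
        (qPow* (p + 1) (divPoch 1 k′ (toPS gfPplus)) ⊕ oneMinusQPow* (2 * p + 2 * suc k′ + 2) (toPS gfDk))
      identity = begin
        toPS gfD                 ≈⟨ D≈ ⟩
        series (X? m)            ≈⟨ D-identity ⟩
        divPoch a (suc (suc m)) F
          ≈⟨ divPoch-cong a (suc (suc m)) (λ N → cong₂ ℤ._+_ (qPow*-cong (suc p) (divPoch-cong 1 k′ (≈-sym P≈)) N)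
                                                           (oneMinusQPow*-cong (a + a) (≈-sym Dk≈) N)) ⟩
        divPoch a (suc (suc m)) (qPow* (suc p) (divPoch 1 k′ (toPS gfPplus)) ⊕ oneMinusQPow* (a + a) (toPS gfDk))
          ≈⟨ exponents (a≡ p k′) (ℕP.+-comm 2 m) (ℕP.+-comm 1 p) (2a≡ p k′) ⟩
        divPoch (p + suc k′ + 1) (m + 2)
          (qPow* (p + 1) (divPoch 1 k′ (toPS gfPplus)) ⊕ oneMinusQPow* (2 * p + 2 * suc k′ + 2) (toPS gfDk)) ∎
        where
        open ≈-Reasoning
        a≡ : ∀ p k′ → suc (suc (k′ + p)) ≡ p + suc k′ + 1
        a≡ = solve-∀
        2a≡ : ∀ p k′ → suc (suc (k′ + p)) + suc (suc (k′ + p)) ≡ 2 * p + 2 * suc k′ + 2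
        2a≡ = solve-∀

open Assembly using (below-unique-maximal; ¬¬-decidable; module WithDecidableOrder)

-- Lemma 3.4.  The order of P is decidable up to double negation, which suffices
-- for an equation between integers.
lemma3p4 : (p : ℕ) (_≤P_ : Rel (Fin p) 0ℓ) → IsPartialOrder _≡_ _≤P_ →
    (y1 y2 : Fin p) → UniqueMaximal _≤P_ y1 → CoveredBy _≤P_ y2 y1 →
    (m k : ℕ) → 1 ≤ m → 1 ≤ k →
    (gfD gfPplus gfDk : ℕ → ℕ) →
    IsGF (DOrder _≤P_ y1 y2 m k) gfD →
    IsGF (PlusOrder _≤P_) gfPplus →
    IsGF (DkOrder _≤P_ y1 y2 m k) gfDk →
    ∀ N → toPS gfD N ≡
      divPoch (p + k + 1) (m + 2)
        (qPow* (p + 1) (divPoch 1 (k ∸ 1) (toPS gfPplus))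
          ⊕ oneMinusQPow* (2 * p + 2 * k + 2) (toPS gfDk)) N
lemma3p4 p _≤P_ isPO y1 y2 maximal _ m (suc k′) _ _ gfD gfPplus gfDk HD HP HDk N =
  decidable-stable (toPS gfD N ℤ.≟ _)
    (¬¬-map (λ _≤P?_ → WithDecidableOrder.identity _≤P_ _≤P?_ y1 y2 (below-unique-maximal isPO _≤P?_ maximal) k′ m
                         gfD gfPplus gfDk HD HP HDk N)
            (¬¬-decidable _≤P_))
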